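{- Let $\alpha$ be an ordinal with $3\le\alpha<\varepsilon_0$ and $A,B$ two languages. If $A\le_T^{\mathscr F_{<\alpha}}B$ and $B\in\mathbf F_\alpha$, then $A\in\mathbf F_\alpha$.
   Context: Ordinals are below $\varepsilon_0$ in Cantor normal form; limit ordinals have fundamental sequences $(\gamma+\omega^{\beta+1})(x)=\gamma+\omega^\beta\cdot(x+1)$, $(\gamma+\omega^{\lambda'})(x)=\gamma+\omega^{\lambda'(x)}$ for $\lambda'$ limit. Fast-growing functions: $F_0(x)=x+1$, $F_{\alpha+1}(x)=F_\alpha^{x+1}(x)$, $F_\lambda(x)=F_{\lambda(x)}(x)$. Extended Grzegorczyk class $\mathscr F_\alpha$: smallest class of functions $\mathbb N^k\to\mathbb N$ containing the zero function, addition, projections and $F_\alpha$, closed under composition and limited primitive recursion (primitive recursion bounded by some function of the class applied to the max of the arguments). $\mathscr F_{<\alpha}=\bigcup_{\beta<\alpha}\mathscr F_\beta$. $\mathrm{DTime}(t(n))$: languages decided by a deterministic Turing machine in at most $t(n)$ steps on inputs of length $n$. $\mathbf F_\alpha=\bigcup_{p\in\mathscr F_{<\alpha}}\mathrm{DTime}(F_\alpha(p(n)))$ ($p$ unary). Turing reductions: $A\le_T^f B$ if there is an oracle Turing machine with oracle $B$ deciding $A$ in deterministic time $f(n)$; $A\le_T^{\mathcal C}B$ if $A\le_T^f B$ for some $f\in\mathcal C$. -}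

module Defs where

open import Data.Nat as ℕ using (ℕ; zero; suc; _⊔_; _≤_)
open import Data.Fin using (Fin; _≟_)
open import Data.Vec using (Vec; []; _∷_; foldr; tabulate)
open import Data.List using (List; length)
open import Data.Maybe using (Maybe; just; nothing)
open import Data.Bool using (Bool; true; false; if_then_else_)
open import Data.Sum using (_⊎_; inj₁; inj₂)
open import Data.Product using (Σ; _×_; _,_; ∃; ∃-syntax)
open import Relation.Nullary using (¬_; does)
open import Relation.Binary.PropositionalEquality using (_≡_; _≢_)

data Ord : Set where
  𝟎    : Ord
  ω^_+_ : Ord → Ord → Ord

infixr 30 ω^_+_
infix 4 _<ₒ_ _≤ₒ_ _≥lead_

data _<ₒ_ : Ord → Ord → Set where
  0<  : ∀ {a b} → 𝟎 <ₒ ω^ a + b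
  exp< : ∀ {a b c d} → a <ₒ c → ω^ a + b <ₒ ω^ c + d
  tail< : ∀ {a b d} → b <ₒ d → ω^ a + b <ₒ ω^ a + d

_≤ₒ_ : Ord → Ord → Set
a ≤ₒ b = a <ₒ b ⊎ a ≡ b

data _≥lead_ (a : Ord) : Ord → Set where
  lead𝟎 : a ≥lead 𝟎
  leadω : ∀ {c d} → c ≤ₒ a → a ≥lead (ω^ c + d)

data NF : Ord → Set where
  nf𝟎 : NF 𝟎
  nfω : ∀ {a b} → NF a → NF b → a ≥lead b → NF (ω^ a + b)

fin : ℕ → Ord
fin zero    = 𝟎
fin (suc n) = ω^ 𝟎 + fin n

pred? : Ord → Maybe Ord
pred? 𝟎 = nothing
pred? (ω^ 𝟎 + 𝟎) = just 𝟎
pred? (ω^ (ω^ _ + _) + 𝟎) = nothing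
pred? (ω^ a + (ω^ c + d)) with pred? (ω^ c + d)
... | just p  = just (ω^ a + p)
... | nothing = nothing

IsZero : Ord → Set
IsZero a = a ≡ 𝟎

IsLimit : Ord → Set
IsLimit a = (a ≢ 𝟎) × (pred? a ≡ nothing)

copies : Ord → ℕ → Ord
copies a zero    = 𝟎
copies a (suc n) = ω^ a + copies a n

-- fundamental sequences:
--   (γ + ω^(β+1))(x) = γ + ω^β·(x+1),   (γ + ω^λ')(x) = γ + ω^(λ'(x))
mutual
  fs : Ord → ℕ → Ord
  fs 𝟎 x = 𝟎
  fs (ω^ a + 𝟎) x = fsTerm a (pred? a) x
  fs (ω^ a + (ω^ c + d)) x = ω^ a + fs (ω^ c + d) x

  fsTerm : Ord → Maybe Ord → ℕ → Ord
  fsTerm a (just p) x = copies p (suc x)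
  fsTerm 𝟎 nothing x = 𝟎
  fsTerm (ω^ b + c) nothing x = ω^ (fs (ω^ b + c) x) + 𝟎

-- Fast-growing functions, as their (inductively defined) graph:
--   FG α x y  means  F_α(x) = y

mutual
  data FG : Ord → ℕ → ℕ → Set where
    F-zero : ∀ {x} → FG 𝟎 x (suc x)
    F-succ : ∀ {α β x y} → pred? α ≡ just β → Iter β (suc x) x y → FG α x y
    F-lim  : ∀ {α x y} → IsLimit α → FG (fs α x) x y → FG α x y

  data Iter (β : Ord) : ℕ → ℕ → ℕ → Set where
    it-zero : ∀ {x} → Iter β zero x x
    it-suc  : ∀ {n x y z} → FG β x y → Iter β n y z → Iter β (suc n) x z

maxV : ∀ {k} → Vec ℕ k → ℕ
maxV = foldr _ _⊔_ 0

data InF (α : Ord) : (k : ℕ) → (Vec ℕ k → ℕ) → Set where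
  c-zero : ∀ {k} {f : Vec ℕ k → ℕ} → (∀ v → f v ≡ 0) → InF α k f
  c-add  : ∀ {f : Vec ℕ 2 → ℕ} → (∀ x y → f (x ∷ y ∷ []) ≡ x ℕ.+ y) → InF α 2 f
  c-proj : ∀ {k} (i : Fin k) {f : Vec ℕ k → ℕ} → (∀ v → f v ≡ Data.Vec.lookup v i) → InF α k f
  c-F    : ∀ {f : Vec ℕ 1 → ℕ} → (∀ x → FG α x (f (x ∷ []))) → InF α 1 f
  c-comp : ∀ {k m} (h : Vec ℕ m → ℕ) (gs : Fin m → Vec ℕ k → ℕ) {f : Vec ℕ k → ℕ}
           → InF α m h → (∀ i → InF α k (gs i))
           → (∀ v → f v ≡ h (tabulate (λ i → gs i v)))
           → InF α k f
  c-lrec : ∀ {k} (g : Vec ℕ k → ℕ) (h : Vec ℕ (suc (suc k)) → ℕ) (b : Vec ℕ 1 → ℕ)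
           {f : Vec ℕ (suc k) → ℕ}
           → InF α k g → InF α (suc (suc k)) h → InF α 1 b
           → (∀ ys → f (0 ∷ ys) ≡ g ys)
           → (∀ x ys → f (suc x ∷ ys) ≡ h (x ∷ f (x ∷ ys) ∷ ys))
           → (∀ v → f v ≤ b (maxV v ∷ []))
           → InF α (suc k) f

InF< : Ord → (k : ℕ) → (Vec ℕ k → ℕ) → Set
InF< α k f = ∃[ β ] (NF β × β <ₒ α × InF β k f)

Lang : ℕ → Set
Lang a = List (Fin a) → Bool

data Move : Set where
  L R S : Move

-- tape alphabet: blank (nothing), input symbols, oracle symbols, work symbols
Γ : ℕ → ℕ → ℕ → Set
Γ a b w = Maybe (Fin a ⊎ Fin b ⊎ Fin w)

-- deterministic oracle Turing machine with input alphabet Fin a and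
-- oracle alphabet Fin b, with a main (input/work) tape and an oracle tape,
-- both one-way infinite.
record OTM (a b : ℕ) : Set where
  field
    nstates : ℕ
    nwork   : ℕ
    start accept reject query qyes qno : Fin nstates
    δ : Fin nstates → Γ a b nwork → Γ a b nwork
        → Fin nstates × Γ a b nwork × Move × Γ a b nwork × Move

module _ {a b : ℕ} (M : OTM a b) where
  open OTM M

  -- a one-way infinite tape: finitely many explicitly stored cells,
  -- all further cells blank
  Tape : Set
  Tape = List (Γ a b nwork)

  record Config : Set where
    constructor conf
    field
      state : Fin nstates
      mtape : Tape
      mhead : ℕ
      otape : Tape
      ohead : ℕ

  readCell : Tape → ℕ → Γ a b nwork
  readCell Data.List.[] _ = nothing
  readCell (x Data.List.∷ xs) zero = x
  readCell (x Data.List.∷ xs) (suc i) = readCell xs i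

  write : Tape → ℕ → Γ a b nwork → Tape
  write Data.List.[] zero s = s Data.List.∷ Data.List.[]
  write Data.List.[] (suc i) s = nothing Data.List.∷ write Data.List.[] i s
  write (x Data.List.∷ xs) zero s = s Data.List.∷ xs
  write (x Data.List.∷ xs) (suc i) s = x Data.List.∷ write xs i s

  move : Move → ℕ → ℕ
  move L i = i ℕ.∸ 1
  move R i = suc i
  move S i = i

  queryWord : Tape → List (Fin b)
  queryWord Data.List.[] = Data.List.[]
  queryWord (just (inj₂ (inj₁ c)) Data.List.∷ xs) = c Data.List.∷ queryWord xs
  queryWord (_ Data.List.∷ xs) = Data.List.[]

  blank : Tape
  blank = Data.List.[]

  step : Lang b → Config → Config
  step B c@(conf s mt mh ot oh) with does (s ≟ accept) | does (s ≟ reject) | does (s ≟ query)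
  ... | true  | _     | _     = c
  ... | false | true  | _     = c
  ... | false | false | true  =
        conf (if B (queryWord ot) then qyes else qno) mt mh blank 0
  ... | false | false | false with δ s (readCell mt mh) (readCell ot oh)
  ...   | (s' , wm , dm , wo , dO) =
        conf s' (write mt mh wm) (move dm mh) (write ot oh wo) (move dO oh)

  run : Lang b → ℕ → Config → Config
  run B zero    c = c
  run B (suc k) c = run B k (step B c)

  inputTape : List (Fin a) → Tape
  inputTape w = Data.List.map (λ x → just (inj₁ x)) w

  initial : List (Fin a) → Config
  initial w = conf start (inputTape w) 0 blank 0

  result : Config → Maybe Bool
  result c with does (Config.state c ≟ accept) | does (Config.state c ≟ reject)
  ... | true  | _     = just true
  ... | false | true  = just false
  ... | false | false = nothing

  DecidesIn : Lang b → Lang a → (ℕ → ℕ) → Set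
  DecidesIn B A t = ∀ (w : List (Fin a)) →
    result (run B (t (length w)) (initial w)) ≡ just (A w)

noOracle : Lang 0
noOracle _ = false

-- DTime(t(n)): decided by a deterministic TM (an oracle machine never
-- consulting a meaningful oracle) within t(n) steps
DTime : ∀ {a} → (ℕ → ℕ) → Lang a → Set
DTime {a} t A = Σ (OTM a 0) λ M → DecidesIn M noOracle A t

_≤T[_]_ : ∀ {a b} → Lang a → (ℕ → ℕ) → Lang b → Set
_≤T[_]_ {a} {b} A f B = Σ (OTM a b) λ M → DecidesIn M B A f

≤T-F< : ∀ {a b} → Ord → Lang a → Lang b → Set
≤T-F< α A B = ∃[ f ] (InF< α 1 f × (A ≤T[ (λ n → f (n ∷ [])) ] B))

𝐅 : ∀ {a} → Ord → Lang a → Set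
𝐅 α A = ∃[ p ] (InF< α 1 p × ∃[ t ] ((∀ n → FG α (p (n ∷ [])) (t n)) × DTime t A))

module Submission where

-- Let M_A decide A with oracle B in time f, and let M_B decide B in time F_α ∘ p, where f
-- and p lie in classes below α. Running M_B on the queries of M_A takes time polynomial in
-- N = f(n) and V = max of F_α ∘ p up to N. Functions of the class of β are bounded by
-- iterates of F_δ for every nonzero δ ≥ β, so with one δ < α for both machines N and V are
-- at most F_α(F_δ^k(n)). For α ≥ 3 a polynomial is absorbed by a shift of the argument,
-- because F_2(F_α(x)) ≤ F_α(x + 1) for large x; hence F_δ^K works as the new p.
-- Comparisons of F_α with F_β go through the pointwise order x ⊢ β ≼ α: β is reached from α
-- by predecessors and by passing from a limit λ to λ(x).
--
-- The two tapes of M_A and the two of M_B share two tapes: main with main, oracle with oracle.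
-- A query copies the query word from tape 2 to M_B's track of tape 1. A query of the compiled
-- machine itself, whose oracle is void, serves to wipe tape 2.

open import Defs
open import Data.Nat using (ℕ; zero; suc; _+_; _*_; _∸_; _⊔_; _≤_; _<_; z≤n; s≤s;
  _≤′_; ≤′-refl; ≤′-step; _≡ᵇ_)
open import Data.Nat.Properties hiding (_≟_)
open import Data.Nat.Tactic.RingSolver using (solve-∀)
open import Data.Bool using (Bool; true; false; if_then_else_; T; _∧_)
open import Data.Fin using (Fin; _≟_; combine; remQuot; join; splitAt)
import Data.Fin as Fin
open import Data.Fin.Properties using (remQuot-combine; splitAt-join)
open import Data.List using (List; []; _∷_; length)
open import Data.List.Properties using (length-map)
open import Data.Maybe using (Maybe; just; nothing; fromMaybe; maybe′)
import Data.Maybe as Maybe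
open import Data.Maybe.Properties using (just-injective)
open import Data.Product using (Σ; _×_; _,_; ∃-syntax; proj₁; proj₂)
import Data.Product as Product
open import Data.Sum using (_⊎_; inj₁; inj₂)
import Data.Sum as Sum
open import Data.Vec using (Vec; []; _∷_; lookup; tabulate)
open import Function using (_∘_)
open import Relation.Nullary using (contradiction; does; yes; no)
open import Relation.Nullary.Decidable using (dec-true; dec-false)
open import Relation.Binary.PropositionalEquality
  using (_≡_; _≢_; _≗_; refl; sym; trans; cong; cong₂; subst; subst₂)

-- Ordinals compared along fundamental sequences

private variable
  α β γ : Ord
  x y z : ℕ

pred?-tail : ∀ a c d → pred? (ω^ a + (ω^ c + d)) ≡ Maybe.map (ω^ a +_) (pred? (ω^ c + d))
pred?-tail 𝟎 c d with pred? (ω^ c + d)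
... | just _  = refl
... | nothing = refl
pred?-tail (ω^ _ + _) c d with pred? (ω^ c + d)
... | just _  = refl
... | nothing = refl

pred?-just-tail : ∀ a {b p} → pred? b ≡ just p → pred? (ω^ a + b) ≡ just (ω^ a + p)
pred?-just-tail a {ω^ c + d} eq = trans (pred?-tail a c d) (cong (Maybe.map (ω^ a +_)) eq)

limit-tail : ∀ a {b} → IsLimit b → IsLimit (ω^ a + b)
limit-tail a {𝟎} (b≢𝟎 , _) = contradiction refl b≢𝟎
limit-tail a {ω^ c + d} (_ , eq) = (λ ()) , trans (pred?-tail a c d) (cong (Maybe.map (ω^ a +_)) eq)

fs-tail : ∀ a {b} → IsLimit b → ∀ x → fs (ω^ a + b) x ≡ ω^ a + fs b x
fs-tail a {𝟎} (b≢𝟎 , _) = contradiction refl b≢𝟎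
fs-tail a {ω^ c + d} _ x = refl

limit-exp : ∀ {a} → a ≢ 𝟎 → IsLimit (ω^ a + 𝟎)
limit-exp {𝟎} a≢𝟎 = contradiction refl a≢𝟎
limit-exp {ω^ _ + _} _ = (λ ()) , refl

pred?-just⇒≢𝟎 : pred? α ≡ just β → α ≢ 𝟎
pred?-just⇒≢𝟎 () refl

fs-exp-suc : ∀ a {p} → pred? a ≡ just p → ∀ x → fs (ω^ a + 𝟎) x ≡ copies p (suc x)
fs-exp-suc a eq x rewrite eq = refl

fs-exp-lim : ∀ {a} → IsLimit a → ∀ x → fs (ω^ a + 𝟎) x ≡ ω^ (fs a x) + 𝟎
fs-exp-lim {𝟎} (a≢𝟎 , _) x = contradiction refl a≢𝟎
fs-exp-lim {ω^ _ + _} (_ , eq) x rewrite eq = refl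

-- Certifies termination of recursion along `pred?` and `fs`. `tree` supplies it for every term, in
-- normal form or not, so `F` can be defined on all of `Ord`.
data Tree : Ord → Set where
  tree-zero : Tree 𝟎
  tree-suc  : pred? α ≡ just β → Tree β → Tree α
  tree-lim  : IsLimit α → (∀ x → Tree (fs α x)) → Tree α

-- Predecessors and fundamental sequences act on the tail until it has become `𝟎`; from there the
-- tree of `ω^ a + 𝟎` takes over.
tree-tail : ∀ a {b} → Tree (ω^ a + 𝟎) → Tree b → Tree (ω^ a + b)
tree-tail a ta tree-zero       = ta
tree-tail a ta (tree-suc eq t) = tree-suc (pred?-just-tail a eq) (tree-tail a ta t)
tree-tail a ta (tree-lim l ts) =
  tree-lim (limit-tail a l) λ x → subst Tree (sym (fs-tail a l x)) (tree-tail a ta (ts x))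

tree-copies : ∀ p n → Tree (ω^ p + 𝟎) → Tree (copies p n)
tree-copies p zero    t = tree-zero
tree-copies p (suc n) t = tree-tail p t (tree-copies p n t)

-- Induction on the tree of the exponent: for a successor exponent the fundamental sequence consists
-- of finite sums of `ω^ p`, which `tree-copies` handles.
tree-exp : ∀ {a} → Tree a → Tree (ω^ a + 𝟎)
tree-exp tree-zero       = tree-suc refl tree-zero
tree-exp {a} (tree-suc {β = p} eq t) = tree-lim (limit-exp (pred?-just⇒≢𝟎 eq))
  λ x → subst Tree (sym (fs-exp-suc a eq x)) (tree-copies p (suc x) (tree-exp t))
tree-exp (tree-lim l ts) = tree-lim (limit-exp (proj₁ l))
  λ x → subst Tree (sym (fs-exp-lim l x)) (tree-exp (ts x))

tree : ∀ α → Tree α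
tree 𝟎          = tree-zero
tree (ω^ a + b) = tree-tail a (tree-exp (tree a)) (tree b)

-- The pointwise order

infix 4 _⊢_≼_

data _⊢_≼_ (x : ℕ) : Ord → Ord → Set where
  ≼-refl : x ⊢ α ≼ α
  ≼-suc  : pred? α ≡ just β → x ⊢ γ ≼ β → x ⊢ γ ≼ α
  ≼-lim  : IsLimit α → x ⊢ γ ≼ fs α x → x ⊢ γ ≼ α

≼-trans : x ⊢ α ≼ β → x ⊢ β ≼ γ → x ⊢ α ≼ γ
≼-trans p ≼-refl       = p
≼-trans p (≼-suc eq q) = ≼-suc eq (≼-trans p q)
≼-trans p (≼-lim l q)  = ≼-lim l (≼-trans p q)

𝟎≼ : ∀ α → x ⊢ 𝟎 ≼ α
𝟎≼ α = go (tree α)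
  where
  go : Tree γ → x ⊢ 𝟎 ≼ γ
  go tree-zero       = ≼-refl
  go (tree-suc eq t) = ≼-suc eq (go t)
  go {x = x} (tree-lim l ts) = ≼-lim l (go (ts x))

≼-tail : ∀ a → x ⊢ β ≼ α → x ⊢ ω^ a + β ≼ ω^ a + α
≼-tail a ≼-refl       = ≼-refl
≼-tail a (≼-suc eq p) = ≼-suc (pred?-just-tail a eq) (≼-tail a p)
≼-tail {x} a (≼-lim {γ = γ} l p) = ≼-lim (limit-tail a l)
  (subst (x ⊢ ω^ a + γ ≼_) (sym (fs-tail a l x)) (≼-tail a p))

≼-head : ∀ a b → x ⊢ ω^ a + 𝟎 ≼ ω^ a + b
≼-head a b = ≼-tail a (𝟎≼ b)

≼-copies : ∀ p n → x ⊢ copies p n ≼ copies p (suc n)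
≼-copies p zero    = 𝟎≼ _
≼-copies p (suc n) = ≼-tail p (≼-copies p n)

≼-copies-≤ : ∀ p {m n} → m ≤ n → x ⊢ copies p m ≼ copies p n
≼-copies-≤ p m≤n = go (≤⇒≤′ m≤n)
  where
  go : ∀ {m n} → m ≤′ n → x ⊢ copies p m ≼ copies p n
  go ≤′-refl     = ≼-refl
  go (≤′-step q) = ≼-trans (go q) (≼-copies p _)

-- For a successor exponent, index `x` leads to `suc x` copies of `ω^ p`; there is at least one, and
-- the copies behind the first descend to `𝟎`.
≼-exp : ∀ {a b} → x ⊢ b ≼ a → x ⊢ ω^ b + 𝟎 ≼ ω^ a + 𝟎
≼-exp ≼-refl = ≼-refl
≼-exp {x} {a} (≼-suc {β = p} eq q) = ≼-lim (limit-exp (pred?-just⇒≢𝟎 eq))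
  (subst (x ⊢ _ ≼_) (sym (fs-exp-suc a eq x)) (≼-trans (≼-exp q) (≼-head p _)))
≼-exp {x} (≼-lim l q) = ≼-lim (limit-exp (proj₁ l))
  (subst (x ⊢ _ ≼_) (sym (fs-exp-lim l x)) (≼-exp q))

sucₒ : Ord → Ord
sucₒ 𝟎          = ω^ 𝟎 + 𝟎
sucₒ (ω^ a + b) = ω^ a + sucₒ b

pred?-sucₒ : ∀ α → pred? (sucₒ α) ≡ just α
pred?-sucₒ 𝟎          = refl
pred?-sucₒ (ω^ a + b) = pred?-just-tail a (pred?-sucₒ b)

≼-sucₒ : ∀ α → x ⊢ α ≼ sucₒ α
≼-sucₒ α = ≼-suc (pred?-sucₒ α) ≼-refl

sucₒ-copies≼ : ∀ p n → x ⊢ sucₒ (copies p n) ≼ copies p (suc n)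
sucₒ-copies≼ p zero    = ≼-exp (𝟎≼ p)
sucₒ-copies≼ p (suc n) = ≼-tail p (sucₒ-copies≼ p n)

copies≼exp-sucₒ : ∀ p {n} → n ≤ suc x → x ⊢ copies p n ≼ ω^ (sucₒ p) + 𝟎
copies≼exp-sucₒ {x} p n≤ = ≼-lim (limit-exp (pred?-just⇒≢𝟎 (pred?-sucₒ p)))
  (subst (x ⊢ _ ≼_) (sym (fs-exp-suc (sucₒ p) (pred?-sucₒ p) x)) (≼-copies-≤ p n≤))

-- The added one is absorbed by one more copy of the last power. For a limit exponent this takes two
-- copies of `ω^ (fs a x)`, which are below `ω^ (sucₒ (fs a x))` from index 1 on; hence the positive
-- index.
sucₒ-fs≼ : ∀ α → IsLimit α → ∀ x → suc z ⊢ sucₒ (fs α x) ≼ fs α (suc x)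
sucₒ-fs≼ 𝟎 (α≢𝟎 , _) x = contradiction refl α≢𝟎
sucₒ-fs≼ (ω^ a + (ω^ c + d)) (_ , eq) x = ≼-tail a (sucₒ-fs≼ (ω^ c + d) ((λ ()) , tail-lim) x)
  where
  tail-lim : pred? (ω^ c + d) ≡ nothing
  tail-lim with pred? (ω^ c + d) | trans (sym (pred?-tail a c d)) eq
  ... | nothing | _ = refl
sucₒ-fs≼ {z} (ω^ a + 𝟎) (_ , eq) x with pred? a in e
... | just p  = sucₒ-copies≼ p (suc x)
sucₒ-fs≼ {z} (ω^ 𝟎 + 𝟎) (_ , ()) x | nothing
sucₒ-fs≼ {z} (ω^ a@(ω^ _ + _) + 𝟎) (_ , eq) x | nothing =
  ≼-trans (sucₒ-copies≼ (fs a x) 1)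
    (≼-trans (copies≼exp-sucₒ (fs a x) (s≤s (s≤s z≤n)))
      (≼-exp (sucₒ-fs≼ a ((λ ()) , e) x)))

-- Chains `sucₒ-fs≼` from `x` up to `y`. Index zero stands apart, since that lemma asks for a
-- positive one; there `x` is zero too.
fs≼ : IsLimit α → x ≤ y → y ⊢ fs α x ≼ fs α y
fs≼ {α} {y = zero} l z≤n = ≼-refl
fs≼ {α} {x} {y = suc y} l x≤y = go (≤⇒≤′ x≤y)
  where
  go : ∀ {w} → x ≤′ w → suc y ⊢ fs α x ≼ fs α w
  go ≤′-refl         = ≼-refl
  go (≤′-step {w} q) = ≼-trans (go q) (≼-trans (≼-sucₒ _) (sucₒ-fs≼ α l w))

-- A larger index turns each passage to `fs α x` into one to `fs α y`, from which `fs≼` leads back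
-- to `fs α x`.
≼-mono : x ≤ y → x ⊢ β ≼ α → y ⊢ β ≼ α
≼-mono x≤y ≼-refl       = ≼-refl
≼-mono x≤y (≼-suc eq p) = ≼-suc eq (≼-mono x≤y p)
≼-mono x≤y (≼-lim l p)  = ≼-lim l (≼-trans (≼-mono x≤y p) (fs≼ l x≤y))

-- Fast-growing functions

FG-det : FG α x y → FG α x z → y ≡ z
Iter-det : ∀ {n} → Iter α n x y → Iter α n x z → y ≡ z
FG-det F-zero F-zero = refl
FG-det (F-succ e p) (F-succ e′ q) with just-injective (trans (sym e) e′)
... | refl = Iter-det p q
FG-det (F-succ e p) (F-lim (_ , e′) q) = contradiction (trans (sym e) e′) λ ()
FG-det (F-lim (_ , e′) q) (F-succ e p) = contradiction (trans (sym e) e′) λ ()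
FG-det (F-lim _ p) (F-lim _ q) = FG-det p q
FG-det F-zero (F-succ () _)
FG-det F-zero (F-lim (n , _) _) = contradiction refl n
FG-det (F-succ () _) F-zero
FG-det (F-lim (n , _) _) F-zero = contradiction refl n
Iter-det it-zero it-zero = refl
Iter-det (it-suc p ps) (it-suc q qs) with FG-det p q
... | refl = Iter-det ps qs

iter : (ℕ → ℕ) → ℕ → ℕ → ℕ
iter f zero    x = x
iter f (suc n) x = iter f n (f x)

iter-graph : {f : ℕ → ℕ} → (∀ x → FG β x (f x)) → ∀ n x → Iter β n x (iter f n x)
iter-graph g zero    x = it-zero
iter-graph g (suc n) x = it-suc (g x) (iter-graph g n _)

F-tree : Tree α → ℕ → ℕ
F-tree tree-zero x       = suc x
F-tree (tree-suc _ t) x  = iter (F-tree t) (suc x) x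
F-tree (tree-lim _ ts) x = F-tree (ts x) x

F-tree-graph : (t : Tree α) → ∀ x → FG α x (F-tree t x)
F-tree-graph tree-zero x       = F-zero
F-tree-graph (tree-suc e t) x  = F-succ e (iter-graph (F-tree-graph t) (suc x) x)
F-tree-graph (tree-lim l ts) x = F-lim l (F-tree-graph (ts x) x)

-- Opaque, so that type checking does not unfold it. Its equations are recovered from `F-graph` and
-- `FG-det`.
abstract
  F : Ord → ℕ → ℕ
  F α = F-tree (tree α)

  F-graph : ∀ α x → FG α x (F α x)
  F-graph α = F-tree-graph (tree α)

F-zero≡ : ∀ x → F 𝟎 x ≡ suc x
F-zero≡ x = FG-det (F-graph 𝟎 x) F-zero

F-suc : ∀ α → pred? α ≡ just β → ∀ x → F α x ≡ iter (F β) (suc x) x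
F-suc α e x = FG-det (F-graph α x) (F-succ e (iter-graph (F-graph _) (suc x) x))

F-limit : ∀ α → IsLimit α → ∀ x → F α x ≡ F (fs α x) x
F-limit α l x = FG-det (F-graph α x) (F-lim l (F-graph _ x))

module _ {f : ℕ → ℕ} (infl : ∀ x → x < f x) where
  iter-infl : ∀ n x → n + x ≤ iter f n x
  iter-infl zero    x = ≤-refl
  iter-infl (suc n) x = ≤-trans (≤-reflexive (sym (+-suc n x)))
    (≤-trans (+-monoʳ-≤ n (infl x)) (iter-infl n (f x)))

  iter-≤-base : ∀ n x → x ≤ iter f n x
  iter-≤-base n x = ≤-trans (m≤n+m x n) (iter-infl n x)

iter-+ : ∀ (f : ℕ → ℕ) m n x → iter f (m + n) x ≡ iter f n (iter f m x)
iter-+ f zero    n x = refl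
iter-+ f (suc m) n x = iter-+ f m n (f x)

iter-mono : ∀ {f g : ℕ → ℕ} → (∀ {x y} → x ≤ y → f x ≤ g y) → ∀ n → x ≤ y → iter f n x ≤ iter g n y
iter-mono m zero    p = p
iter-mono m (suc n) p = iter-mono m n (m p)

F-infl : ∀ α x → x < F α x
F-infl α = go (tree α)
  where
  go : Tree γ → ∀ x → x < F γ x
  go tree-zero x       = ≤-reflexive (sym (F-zero≡ x))
  go {γ} (tree-suc e t) x  = subst (x <_) (sym (F-suc γ e x)) (≤-trans (go t x) (iter-≤-base (go t) x _))
  go {γ} (tree-lim l ts) x = subst (x <_) (sym (F-limit γ l x)) (go (ts x) x)

-- A descent at index `x` follows the evaluation of `F α` at `x`: limit steps keep the value, and a
-- successor step drops `x` of its `suc x` iterations.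
F-mono-≼ : x ⊢ β ≼ α → F β x ≤ F α x
F-mono-≼ ≼-refl = ≤-refl
F-mono-≼ {x} {α = α} (≼-suc {β = β} e p) = ≤-trans (F-mono-≼ p)
  (≤-trans (iter-≤-base (F-infl β) x _) (≤-reflexive (sym (F-suc α e x))))
F-mono-≼ {x} {α = α} (≼-lim l p) = ≤-trans (F-mono-≼ p) (≤-reflexive (sym (F-limit α l x)))

mono-from-step : ∀ {f : ℕ → ℕ} → (∀ x → f x ≤ f (suc x)) → x ≤ y → f x ≤ f y
mono-from-step {x} {f = f} s p = go (≤⇒≤′ p)
  where
  go : ∀ {y} → x ≤′ y → f x ≤ f y
  go ≤′-refl     = ≤-refl
  go (≤′-step q) = ≤-trans (go q) (s _)

F-mono : ∀ α → x ≤ y → F α x ≤ F α y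
F-mono α = mono-from-step (go (tree α))
  where
  go : Tree γ → ∀ x → F γ x ≤ F γ (suc x)
  go tree-zero x = subst₂ _≤_ (sym (F-zero≡ x)) (sym (F-zero≡ (suc x))) (n≤1+n (suc x))
  go {γ} (tree-suc {β = β} e t) x = subst₂ _≤_ (sym (F-suc γ e x)) (sym (F-suc γ e (suc x)))
    (≤-trans (iter-mono (mono-from-step (go t)) (suc x) (n≤1+n x)) once-more)
    where
    once-more : iter (F β) (suc x) (suc x) ≤ iter (F β) (suc (suc x)) (suc x)
    once-more = iter-mono (mono-from-step (go t)) (suc x) (<⇒≤ (F-infl β (suc x)))
  -- Going from `x` to `suc x` changes the ordinal as well as the argument; `fs≼` compares the two
  -- ordinals at the new index.
  go {γ} (tree-lim l ts) x = subst₂ _≤_ (sym (F-limit γ l x)) (sym (F-limit γ l (suc x)))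
    (≤-trans (go (ts x) x) (F-mono-≼ (fs≼ l (n≤1+n x))))

iter-F-mono : ∀ α n → x ≤ y → iter (F α) n x ≤ iter (F α) n y
iter-F-mono α n = iter-mono (F-mono α) n

-- If the leading exponents differ, the chain is ω^a + b + 1 ≼ ω^a·(n+1) ≼ ω^(a+1) ≼ ω^c ≼ ω^c + d.
-- Normal form enters through `lead⇒≼`, which puts a tail with exponents at most `a` below finitely
-- many copies of `ω^ a`.
<ₒ⇒≼ : ∀ β α → NF β → NF α → β <ₒ α → ∃[ k ] k ⊢ sucₒ β ≼ α
lead⇒≼ : ∀ a b → NF a → NF b → a ≥lead b → ∃[ k ] ∃[ n ] k ⊢ sucₒ b ≼ copies a n
<ₒ⇒≼ _ _ _ _ (0< {a} {b}) = 0 , ≼-trans (≼-exp (𝟎≼ a)) (≼-head a b)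
<ₒ⇒≼ (ω^ a + b) (ω^ a + d) (nfω _ nb _) (nfω _ nd _) (tail< p) with <ₒ⇒≼ b d nb nd p
... | k , q = k , ≼-tail a q
<ₒ⇒≼ (ω^ a + b) (ω^ c + d) (nfω na nb lb) (nfω nc nd _) (exp< p)
  with <ₒ⇒≼ a c na nc p | lead⇒≼ a b na nb lb
-- The maximum includes `n`, because index `x` has room for `suc x` copies of `ω^ a`.
... | k , q | k′ , n , r = k ⊔ k′ ⊔ n ,
  ≼-trans (≼-tail a (≼-mono (≤-trans (m≤n⊔m k k′) (m≤m⊔n _ n)) r))
    (≼-trans (copies≼exp-sucₒ a {suc n} (s≤s (m≤n⊔m _ n)))
      (≼-trans (≼-exp (≼-mono (≤-trans (m≤m⊔n k k′) (m≤m⊔n _ n)) q)) (≼-head c d)))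
lead⇒≼ a 𝟎 na nb lead𝟎 = 0 , 1 , ≼-exp (𝟎≼ a)
lead⇒≼ a (ω^ .a + b) na (nfω _ nb lb) (leadω (inj₂ refl)) with lead⇒≼ a b na nb lb
... | k , n , q = k , suc n , ≼-tail a q
lead⇒≼ a (ω^ c + d) na nb (leadω (inj₁ p)) with <ₒ⇒≼ (ω^ c + d) (ω^ a + 𝟎) nb (nfω na nf𝟎 lead𝟎) (exp< p)
... | k , q = k , 1 , q

iter-mono-count : ∀ {f : ℕ → ℕ} → (∀ x → x < f x) → ∀ {m n} → m ≤ n → ∀ x → iter f m x ≤ iter f n x
iter-mono-count infl (z≤n {n}) x = iter-≤-base infl n x
iter-mono-count infl (s≤s p)   x = iter-mono-count infl p _

<ₒ-trans : α <ₒ β → β <ₒ γ → α <ₒ γ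
<ₒ-trans 0<        (exp< _)  = 0<
<ₒ-trans 0<        (tail< _) = 0<
<ₒ-trans (exp< p)  (exp< q)  = exp< (<ₒ-trans p q)
<ₒ-trans (exp< p)  (tail< _) = exp< p
<ₒ-trans (tail< _) (exp< q)  = exp< q
<ₒ-trans (tail< p) (tail< q) = tail< (<ₒ-trans p q)

<ₒ-≤ₒ-trans : α <ₒ β → β ≤ₒ γ → α <ₒ γ
<ₒ-≤ₒ-trans p (inj₁ q)    = <ₒ-trans p q
<ₒ-≤ₒ-trans p (inj₂ refl) = p

≤ₒ-trans : α ≤ₒ β → β ≤ₒ γ → α ≤ₒ γ
≤ₒ-trans (inj₁ p)    q = inj₁ (<ₒ-≤ₒ-trans p q)
≤ₒ-trans (inj₂ refl) q = q

≤ₒ-tail : ∀ a → α ≤ₒ β → ω^ a + α ≤ₒ ω^ a + β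
≤ₒ-tail a (inj₁ p)    = inj₁ (tail< p)
≤ₒ-tail a (inj₂ refl) = inj₂ refl

≤ₒ-total : ∀ α β → α ≤ₒ β ⊎ β ≤ₒ α
≤ₒ-total 𝟎          𝟎          = inj₁ (inj₂ refl)
≤ₒ-total 𝟎          (ω^ _ + _) = inj₁ (inj₁ 0<)
≤ₒ-total (ω^ _ + _) 𝟎          = inj₂ (inj₁ 0<)
≤ₒ-total (ω^ a + b) (ω^ c + d) with ≤ₒ-total a c
... | inj₁ (inj₁ p) = inj₁ (inj₁ (exp< p))
... | inj₂ (inj₁ p) = inj₂ (inj₁ (exp< p))
... | inj₁ (inj₂ refl) = Sum.map (≤ₒ-tail a) (≤ₒ-tail a) (≤ₒ-total b d)
... | inj₂ (inj₂ refl) = Sum.map (≤ₒ-tail a) (≤ₒ-tail a) (≤ₒ-total b d)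

-- Bounds for the extended Grzegorczyk classes

NF-below : Ord → Set
NF-below α = Σ Ord λ β → NF β × β <ₒ α

common-bound : ((β , _) (γ , _) : NF-below α) → Σ (NF-below α) λ (δ , _) → β ≤ₒ δ × γ ≤ₒ δ
common-bound b@(β , _) c@(γ , _) with ≤ₒ-total β γ
... | inj₁ p = c , p , inj₂ refl
... | inj₂ p = b , inj₂ refl , p

≤ₒ⇒≼ : NF β → NF α → β ≤ₒ α → ∃[ k ] k ⊢ β ≼ α
≤ₒ⇒≼ nβ nα (inj₁ p) with <ₒ⇒≼ _ _ nβ nα p
... | k , q = k , ≼-trans (≼-sucₒ _) q
≤ₒ⇒≼ nβ nα (inj₂ refl) = 0 , ≼-refl

iter-last : ∀ (f : ℕ → ℕ) n x → iter f (suc n) x ≡ f (iter f n x)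
iter-last f zero    x = refl
iter-last f (suc n) x = iter-last f n (f x)

-- The pointwise comparison is available only for arguments that are at least `k`. Applying `F δ`
-- `k` times first lifts every argument that far.
F-dominated : ∀ {β δ} → NF β → NF δ → β ≤ₒ δ → ∃[ k ] (∀ x → F β x ≤ iter (F δ) k x)
F-dominated {β} {δ} nβ nδ p with ≤ₒ⇒≼ nβ nδ p
... | k , q = suc k , λ x → begin
  F β x                     ≤⟨ F-mono β (iter-≤-base (F-infl δ) k x) ⟩
  F β (iter (F δ) k x)      ≤⟨ F-mono-≼ (≼-mono (≤-trans (m≤m+n k x) (iter-infl (F-infl δ) k x)) q) ⟩
  F δ (iter (F δ) k x)      ≡⟨ iter-last (F δ) k x ⟨
  iter (F δ) (suc k) x      ∎
  where open ≤-Reasoning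

iter-suc : ∀ n x → iter (F 𝟎) n x ≡ n + x
iter-suc zero    x = refl
iter-suc (suc n) x = trans (cong (iter (F 𝟎) n) (F-zero≡ x)) (trans (iter-suc n (suc x)) (+-suc n x))

F-fin1 : ∀ x → F (fin 1) x ≡ suc (x + x)
F-fin1 x = trans (F-suc (fin 1) refl x) (iter-suc (suc x) x)

-- Every nonzero `δ` descends to 1 at every index, so small arguments are no exception.
double≤F : ∀ δ → fin 1 ≤ₒ δ → ∀ x → suc (x + x) ≤ F δ x
double≤F 𝟎          (inj₁ ()) x
double≤F 𝟎          (inj₂ ()) x
double≤F (ω^ a + b) p x = ≤-trans (≤-reflexive (sym (F-fin1 x)))
  (F-mono-≼ (≼-trans (≼-exp (𝟎≼ a)) (≼-head a b)))

maxV-lookup : ∀ {k} (v : Vec ℕ k) i → lookup v i ≤ maxV v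
maxV-lookup (x ∷ v) Fin.zero    = m≤m⊔n x _
maxV-lookup (x ∷ v) (Fin.suc i) = ≤-trans (maxV-lookup v i) (m≤n⊔m x _)

maxV-tabulate : ∀ {k} (g : Fin k → ℕ) {u} → (∀ i → g i ≤ u) → maxV (tabulate g) ≤ u
maxV-tabulate {zero}  g p = z≤n
maxV-tabulate {suc k} g p = ⊔-lub (p Fin.zero) (maxV-tabulate (λ i → g (Fin.suc i)) (λ i → p (Fin.suc i)))

finite-bound : ∀ {m} (k : Fin m → ℕ) → ∃[ K ] (∀ i → k i ≤ K)
finite-bound k = maxV (tabulate k) , λ i → go k i
  where
  go : ∀ {m} (k : Fin m → ℕ) i → k i ≤ maxV (tabulate k)
  go k Fin.zero    = m≤m⊔n _ _
  go k (Fin.suc i) = ≤-trans (go (λ i → k (Fin.suc i)) i) (m≤n⊔m (k Fin.zero) _)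

-- Induction on the derivation. Composition adds up iteration counts, and limited recursion inherits
-- the count of its bound. Addition is the case that needs `δ` nonzero: iterates of `F 𝟎` add
-- constants only.
InF-bounded : ∀ {δ β} → fin 1 ≤ₒ δ → NF β → NF δ → β ≤ₒ δ → ∀ {k f} → InF β k f →
  ∃[ n ] (∀ v → f v ≤ iter (F δ) n (maxV v))
InF-bounded {δ} {β} 1≤δ nβ nδ β≤δ = go
  where
  go : ∀ {k f} → InF β k f → ∃[ n ] (∀ v → f v ≤ iter (F δ) n (maxV v))
  go (c-zero e) = 0 , λ v → ≤-trans (≤-reflexive (e v)) z≤n
  go (c-add e) = 1 , λ { v@(x ∷ y ∷ []) → begin
      _                      ≡⟨ e x y ⟩
      x + y                  ≤⟨ +-mono-≤ (maxV-lookup v Fin.zero) (maxV-lookup v (Fin.suc Fin.zero)) ⟩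
      maxV v + maxV v        ≤⟨ n≤1+n _ ⟩
      suc (maxV v + maxV v)  ≤⟨ double≤F δ 1≤δ (maxV v) ⟩
      F δ (maxV v)           ∎ }
    where open ≤-Reasoning
  go (c-proj i e) = 0 , λ v → ≤-trans (≤-reflexive (e v)) (maxV-lookup v i)
  go (c-F e) with F-dominated nβ nδ β≤δ
  ... | n , p = n , λ { v@(x ∷ []) → ≤-trans (≤-reflexive (FG-det (e x) (F-graph β x)))
                                     (≤-trans (p x) (iter-F-mono δ n (maxV-lookup v Fin.zero))) }
  go (c-comp h gs hh hgs e) with go hh | finite-bound (λ i → proj₁ (go (hgs i)))
  ... | n , p | m , q = m + n , λ v → begin
      _                                          ≡⟨ e v ⟩
      h (tabulate (λ i → gs i v))                ≤⟨ p _ ⟩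
      iter (F δ) n (maxV (tabulate λ i → gs i v))
        ≤⟨ iter-F-mono δ n (maxV-tabulate (λ i → gs i v) λ i →
             ≤-trans (proj₂ (go (hgs i)) v) (iter-mono-count (F-infl δ) (q i) (maxV v))) ⟩
      iter (F δ) n (iter (F δ) m (maxV v))       ≡⟨ iter-+ (F δ) m n _ ⟨
      iter (F δ) (m + n) (maxV v)                ∎
    where open ≤-Reasoning
  go (c-lrec g h b _ _ hb _ _ e) with go hb
  ... | n , p = n , λ v → ≤-trans (e v) (≤-trans (p (maxV v ∷ [])) (≤-reflexive (cong (iter (F δ) n) (⊔-identityʳ (maxV v)))))

iter-InF : ∀ δ n → InF δ 1 (λ v → iter (F δ) n (lookup v Fin.zero))
iter-InF δ zero    = c-proj Fin.zero (λ _ → refl)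
iter-InF δ (suc n) = c-comp _ (λ _ v → F δ (lookup v Fin.zero)) (iter-InF δ n)
  (λ _ → c-F (F-graph δ)) (λ _ → refl)

-- Polynomials absorbed by a shift of the argument

NF-fin : ∀ n → NF (fin n)
NF-fin zero          = nf𝟎
NF-fin (suc zero)    = nfω nf𝟎 nf𝟎 lead𝟎
NF-fin (suc (suc n)) = nfω nf𝟎 (NF-fin (suc n)) (leadω (inj₂ refl))

pred?-fin : ∀ n → pred? (fin (suc n)) ≡ just (fin n)
pred?-fin zero    = refl
pred?-fin (suc n) = pred?-just-tail 𝟎 {fin (suc n)} (pred?-fin n)

-- `F α x` is `suc x` iterations of `F β`; one more dominates `F (fin 2)`, and `x + 2` iterations
-- are what `F α (suc x)` performs, from a larger start.
F₂∘F-suc : pred? α ≡ just β → x ⊢ fin 2 ≼ β → F (fin 2) (F α x) ≤ F α (suc x)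
F₂∘F-suc {α} {β} {x} e p = begin
  F (fin 2) (F α x)                       ≤⟨ F-mono-≼ (≼-mono (<⇒≤ (F-infl α x)) p) ⟩
  F β (F α x)                             ≡⟨ cong (F β) (F-suc α e x) ⟩
  F β (iter (F β) (suc x) x)              ≡⟨ iter-last (F β) (suc x) x ⟨
  iter (F β) (suc (suc x)) x              ≤⟨ iter-F-mono β (suc (suc x)) (n≤1+n x) ⟩
  iter (F β) (suc (suc x)) (suc x)        ≡⟨ F-suc α e (suc x) ⟨
  F α (suc x)                             ∎
  where open ≤-Reasoning

-- At a limit, the ordinal is first raised to `sucₒ (fs α x)`, where the successor case applies; the
-- result stays below `F α (suc x)` because `sucₒ (fs α x)` is below `fs α (suc x)`.
F₂∘F≤ : x ⊢ fin 3 ≼ α → F (fin 2) (F α x) ≤ F α (suc x)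
F₂∘F≤ {x} ≼-refl = F₂∘F-suc (pred?-fin 2) ≼-refl
F₂∘F≤ (≼-suc e p) = F₂∘F-suc e (≼-trans (≼-sucₒ (fin 2)) p)
F₂∘F≤ {x} {α} (≼-lim l p) = begin
  F (fin 2) (F α x)                     ≡⟨ cong (F (fin 2)) (F-limit α l x) ⟩
  F (fin 2) (F (fs α x) x)              ≤⟨ F-mono (fin 2) (F-mono-≼ (≼-sucₒ (fs α x))) ⟩
  F (fin 2) (F (sucₒ (fs α x)) x)       ≤⟨ F₂∘F-suc (pred?-sucₒ (fs α x)) (≼-trans (≼-sucₒ (fin 2)) p) ⟩
  F (sucₒ (fs α x)) (suc x)             ≤⟨ F-mono-≼ (sucₒ-fs≼ α l x) ⟩
  F (fs α (suc x)) (suc x)              ≡⟨ F-limit α l (suc x) ⟨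
  F α (suc x)                           ∎
  where open ≤-Reasoning

iter-F₁ : ∀ n x → suc n * x ≤ iter (F (fin 1)) n x
iter-F₁ zero    x = ≤-reflexive (*-identityˡ x)
iter-F₁ (suc n) x = begin
  x + suc n * x                        ≤⟨ +-monoˡ-≤ (suc n * x) (≤-trans (n≤1+n x) (m≤m+n (suc x) (n * suc x))) ⟩
  suc n * suc x + suc n * x            ≡⟨ *-distribˡ-+ (suc n) (suc x) x ⟨
  suc n * suc (x + x)                  ≡⟨ cong (suc n *_) (F-fin1 x) ⟨
  suc n * F (fin 1) x                  ≤⟨ iter-F₁ n (F (fin 1) x) ⟩
  iter (F (fin 1)) n (F (fin 1) x)     ∎
  where open ≤-Reasoning

-- `F (fin 2) x` iterates `F (fin 1)` more than `x` times, and each iteration adds at least `x`.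
square≤F₂ : ∀ x → x * x ≤ F (fin 2) x
square≤F₂ x = begin
  x * x                           ≤⟨ *-monoˡ-≤ x (≤-trans (n≤1+n x) (n≤1+n _)) ⟩
  suc (suc x) * x                 ≤⟨ iter-F₁ (suc x) x ⟩
  iter (F (fin 1)) (suc x) x      ≡⟨ F-suc (fin 2) refl x ⟨
  F (fin 2) x                     ∎
  where open ≤-Reasoning

-- The fourth power is what `simulation-time≤` yields; each of its two squarings costs one shift.
square²≤F : x ⊢ fin 3 ≼ α → let z = F α x in (z * z) * (z * z) ≤ F α (suc (suc x))
square²≤F {x} {α} p = begin
  _                                    ≤⟨ *-mono-≤ (square≤F₂ (F α x)) (square≤F₂ (F α x)) ⟩
  F (fin 2) (F α x) * F (fin 2) (F α x)  ≤⟨ *-mono-≤ (F₂∘F≤ p) (F₂∘F≤ p) ⟩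
  F α (suc x) * F α (suc x)              ≤⟨ square≤F₂ (F α (suc x)) ⟩
  F (fin 2) (F α (suc x))                ≤⟨ F₂∘F≤ (≼-mono (n≤1+n x) p) ⟩
  F α (suc (suc x))                      ∎
  where open ≤-Reasoning

-- Machines with structured states and alphabets

-- A retract of `Fin size` rather than a bijection with it, so that `retract-finite` carries
-- finiteness over to any data type or record with an injective code.
record Finite (A : Set) : Set where
  field
    size    : ℕ
    enc     : A → Fin size
    dec     : Fin size → A
    dec-enc : ∀ x → dec (enc x) ≡ x

  enc-injective : ∀ {x y} → enc x ≡ enc y → x ≡ y
  enc-injective e = trans (sym (dec-enc _)) (trans (cong dec e) (dec-enc _))

  enc-≢ : ∀ {x y} → x ≢ y → does (enc x ≟ enc y) ≡ false
  enc-≢ x≢y = dec-false (_ ≟ _) (λ e → x≢y (enc-injective e))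

Fin-finite : ∀ n → Finite (Fin n)
Fin-finite n = record { size = n ; enc = λ i → i ; dec = λ i → i ; dec-enc = λ _ → refl }

retract-finite : ∀ {A B : Set} (f : A → B) (g : B → A) → (∀ x → g (f x) ≡ x) → Finite B → Finite A
retract-finite f g gf fin-B = record
  { size = size ; enc = λ x → enc (f x) ; dec = λ i → g (dec i)
  ; dec-enc = λ x → trans (cong g (dec-enc (f x))) (gf x) }
  where open Finite fin-B

⊎-finite : ∀ {A B : Set} → Finite A → Finite B → Finite (A ⊎ B)
⊎-finite fA fB = record
  { size = A.size + B.size
  ; enc  = λ s → join A.size B.size (Sum.map A.enc B.enc s)
  ; dec  = λ i → Sum.map A.dec B.dec (splitAt A.size i)
  ; dec-enc = λ s → trans (cong (Sum.map A.dec B.dec) (splitAt-join A.size B.size (Sum.map A.enc B.enc s))) (back s) }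
  where
  module A = Finite fA
  module B = Finite fB
  back : ∀ s → Sum.map A.dec B.dec (Sum.map A.enc B.enc s) ≡ s
  back (inj₁ x) = cong inj₁ (A.dec-enc x)
  back (inj₂ y) = cong inj₂ (B.dec-enc y)

×-finite : ∀ {A B : Set} → Finite A → Finite B → Finite (A × B)
×-finite fA fB = record
  { size = A.size * B.size
  ; enc  = λ (x , y) → combine (A.enc x) (B.enc y)
  ; dec  = λ i → Product.map A.dec B.dec (remQuot B.size i)
  ; dec-enc = λ (x , y) → trans (cong (Product.map A.dec B.dec) (remQuot-combine (A.enc x) (B.enc y)))
                            (cong₂ _,_ (A.dec-enc x) (B.dec-enc y)) }
  where
  module A = Finite fA
  module B = Finite fB

Maybe-finite : ∀ {A : Set} → Finite A → Finite (Maybe A)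
Maybe-finite {A} fA = retract-finite {B = A ⊎ Fin 1}
  (maybe′ inj₁ (inj₂ Fin.zero)) Sum.[ just , (λ _ → nothing) ]
  (λ { (just _) → refl ; nothing → refl }) (⊎-finite fA (Fin-finite 1))

Bool-finite : Finite Bool
Bool-finite = retract-finite {B = Fin 2}
  (λ b → if b then Fin.suc Fin.zero else Fin.zero) (λ { Fin.zero → false ; (Fin.suc _) → true })
  (λ { true → refl ; false → refl }) (Fin-finite 2)

-- Tapes as functions and single steps of machines

nth : ∀ {A : Set} → List A → ℕ → Maybe A
nth []       _       = nothing
nth (x ∷ xs) zero    = just x
nth (x ∷ xs) (suc i) = nth xs i

upd : ∀ {A : Set} → (ℕ → A) → ℕ → A → ℕ → A
upd f i c j = if i ≡ᵇ j then c else f j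

upd-same : ∀ {A : Set} (f : ℕ → A) i {c} → upd f i c i ≡ c
upd-same f zero    = refl
upd-same f (suc i) = upd-same (λ j → f (suc j)) i

upd-other : ∀ {A : Set} (f : ℕ → A) {i j c} → i ≢ j → upd f i c j ≡ f j
upd-other f {i} {j} i≢j with i ≡ᵇ j in e
... | false = refl
... | true  = contradiction (≡ᵇ⇒≡ i j (subst T (sym e) _)) i≢j

upd-≗ : ∀ {A : Set} {f g : ℕ → A} {i c} → g i ≡ c → (∀ j → i ≢ j → g j ≡ f j) → upd f i c ≗ g
upd-≗ {f = f} {g} {i} at off j with i Data.Nat.≟ j
... | yes refl = trans (upd-same f i) (sym at)
... | no i≢j   = trans (upd-other f i≢j) (sym (off j i≢j))

upd-cong : ∀ {A : Set} {f g : ℕ → A} → f ≗ g → ∀ i c → upd f i c ≗ upd g i c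
upd-cong f≗g i c j with i ≡ᵇ j
... | true  = refl
... | false = f≗g j

module _ {a b : ℕ} (M : OTM a b) where
  open OTM M

  -- The tests made by `step` and `result`, acceptance first, summarised in one value so that later
  -- proofs branch once.
  data Kind : Set where
    halting : Bool → Kind
    asking working : Kind

  kind : Fin nstates → Kind
  kind s = if does (s ≟ accept) then halting true
           else if does (s ≟ reject) then halting false
           else if does (s ≟ query) then asking else working

  result-halting : ∀ c {r} → kind (Config.state c) ≡ halting r → result M c ≡ just r
  result-halting c e with does (Config.state c ≟ accept) | does (Config.state c ≟ reject) | does (Config.state c ≟ query)
  result-halting c refl | true  | _    | _ = refl
  result-halting c refl | false | true | _ = refl
  result-halting c () | false | false | true
  result-halting c () | false | false | false

  result-just : ∀ c {r} → result M c ≡ just r → kind (Config.state c) ≡ halting r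
  result-just c e with does (Config.state c ≟ accept) | does (Config.state c ≟ reject)
  result-just c refl | true  | _    = refl
  result-just c refl | false | true = refl
  result-just c () | false | false

  module _ (B : Lang b) where
    step-halting : ∀ c {r} → kind (Config.state c) ≡ halting r → step M B c ≡ c
    step-halting c e with does (Config.state c ≟ accept) | does (Config.state c ≟ reject) | does (Config.state c ≟ query)
    step-halting c e | true  | _    | _ = refl
    step-halting c e | false | true | _ = refl
    step-halting c () | false | false | true
    step-halting c () | false | false | false

    step-asking : ∀ s {mt mh ot oh} → kind s ≡ asking →
      step M B (conf s mt mh ot oh) ≡ conf (if B (queryWord M ot) then qyes else qno) mt mh [] 0
    step-asking s e with does (s ≟ accept) | does (s ≟ reject) | does (s ≟ query)
    step-asking s () | true  | _    | _
    step-asking s () | false | true | _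
    step-asking s e  | false | false | true = refl
    step-asking s () | false | false | false

    step-working : ∀ s {mt mh ot oh} → kind s ≡ working →
      let s′ , wm , dm , wo , dO = δ s (readCell M mt mh) (readCell M ot oh) in
      step M B (conf s mt mh ot oh) ≡ conf s′ (write M mt mh wm) (move M dm mh) (write M ot oh wo) (move M dO oh)
    step-working s e with does (s ≟ accept) | does (s ≟ reject) | does (s ≟ query)
    step-working s () | true  | _    | _
    step-working s () | false | true | _
    step-working s () | false | false | true
    step-working s e  | false | false | false = refl

    run-halting : ∀ k c {r} → kind (Config.state c) ≡ halting r → result M (run M B k c) ≡ just r
    run-halting zero    c e = result-halting c e
    run-halting (suc k) c e rewrite step-halting c e = run-halting k c e

  readCell-write : ∀ t i s → readCell M (write M t i s) ≗ upd (readCell M t) i s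
  readCell-write []      zero    s zero    = refl
  readCell-write []      zero    s (suc j) = refl
  readCell-write []      (suc i) s zero    = refl
  readCell-write []      (suc i) s (suc j) = readCell-write [] i s j
  readCell-write (x ∷ t) zero    s zero    = refl
  readCell-write (x ∷ t) zero    s (suc j) = refl
  readCell-write (x ∷ t) (suc i) s zero    = refl
  readCell-write (x ∷ t) (suc i) s (suc j) = readCell-write t i s j

  readCell-nth : ∀ t i → readCell M t i ≡ fromMaybe nothing (nth t i)
  readCell-nth []      i       = refl
  readCell-nth (x ∷ t) zero    = refl
  readCell-nth (x ∷ t) (suc i) = readCell-nth t i

  readCell-input : ∀ w i → readCell M (inputTape M w) i ≡ Maybe.map inj₁ (nth w i)
  readCell-input []      i       = refl
  readCell-input (x ∷ w) zero    = refl
  readCell-input (x ∷ w) (suc i) = readCell-input w i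

  -- `nth`, unlike `readCell`, distinguishes a stored blank from a cell past the end. With
  -- `i ≤ length t` there is no gap to fill with blanks, so exactly one value is set.
  nth-write : ∀ t i s → i ≤ length t → nth (write M t i s) ≗ upd (nth t) i (just s)
  nth-write []      zero    s _       zero    = refl
  nth-write []      zero    s _       (suc j) = refl
  nth-write (x ∷ t) zero    s _       zero    = refl
  nth-write (x ∷ t) zero    s _       (suc j) = refl
  nth-write (x ∷ t) (suc i) s _       zero    = refl
  nth-write (x ∷ t) (suc i) s (s≤s p) (suc j) = nth-write t i s p j

  length-write≤ : ∀ t i s {n} → length t ≤ n → suc i ≤ n → length (write M t i s) ≤ n
  length-write≤ []      zero    s p       q       = q
  length-write≤ []      (suc i) s p       (s≤s q) = s≤s (length-write≤ [] i s z≤n q)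
  length-write≤ (x ∷ t) zero    s p       q       = p
  length-write≤ (x ∷ t) (suc i) s (s≤s p) (s≤s q) = s≤s (length-write≤ t i s p q)

  length-write> : ∀ t i s → i < length (write M t i s)
  length-write> []      zero    s = s≤s z≤n
  length-write> []      (suc i) s = s≤s (length-write> [] i s)
  length-write> (x ∷ t) zero    s = s≤s z≤n
  length-write> (x ∷ t) (suc i) s = s≤s (length-write> t i s)

  length-queryWord : ∀ t → length (queryWord M t) ≤ length t
  length-queryWord []                        = z≤n
  length-queryWord (just (inj₂ (inj₁ c)) ∷ t) = s≤s (length-queryWord t)
  length-queryWord (just (inj₂ (inj₂ _)) ∷ t) = z≤n
  length-queryWord (just (inj₁ _) ∷ t)        = z≤n
  length-queryWord (nothing ∷ t)              = z≤n

  move≤ : ∀ d i → move M d i ≤ suc i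
  move≤ L i = ≤-trans (m∸n≤m i 1) (n≤1+n i)
  move≤ R i = ≤-refl
  move≤ S i = n≤1+n i

shift : Move → ℕ → ℕ
shift L i = i ∸ 1
shift R i = suc i
shift S i = i

shift-move : ∀ {a b} (M : OTM a b) d i → move M d i ≡ shift d i
shift-move M L i = refl
shift-move M R i = refl
shift-move M S i = refl

-- wipe is what remains of a query when the oracle is void: tape 2 is blanked and its head reset.
data Action (Q C₁ C₂ : Set) : Set where
  go   : Q → Maybe C₁ → Move → Maybe C₂ → Move → Action Q C₁ C₂
  wipe : Q → Action Q C₁ C₂
  halt : Bool → Action Q C₁ C₂

-- Symbols are structured, and `raw` interprets the cells of tape 1 that still hold an input symbol
-- or were never written, so the input is converted as it is read.
record Machine (a : ℕ) : Set₁ where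
  field
    Q C₁ C₂   : Set
    Q-finite  : Finite Q
    C₁-finite : Finite C₁
    C₂-finite : Finite C₂
    raw       : Maybe (Fin a) → C₁
    blank₂    : C₂
    start     : Q
    act       : Q → C₁ → C₂ → Action Q C₁ C₂

  overwrite : ∀ {C : Set} → (ℕ → C) → ℕ → Maybe C → ℕ → C
  overwrite f i nothing  = f
  overwrite f i (just c) = upd f i c

  overwrite-cong : ∀ {C : Set} {f g : ℕ → C} → f ≗ g → ∀ i w → overwrite f i w ≗ overwrite g i w
  overwrite-cong f≗g i nothing  = f≗g
  overwrite-cong f≗g i (just c) = upd-cong f≗g i c

  -- `n` is a budget for the rest of the run, not an exact count. Runs are built backwards: each
  -- phase extends the halting of its continuation by its own budget.
  data Halts : ℕ → Q → (ℕ → C₁) → ℕ → (ℕ → C₂) → ℕ → Bool → Set where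
    by-halt : ∀ {n q t₁ i t₂ j r} → act q (t₁ i) (t₂ j) ≡ halt r → Halts (suc n) q t₁ i t₂ j r
    by-go : ∀ {n q t₁ i t₂ j r q′ w₁ d₁ w₂ d₂} → act q (t₁ i) (t₂ j) ≡ go q′ w₁ d₁ w₂ d₂ →
      Halts n q′ (overwrite t₁ i w₁) (shift d₁ i) (overwrite t₂ j w₂) (shift d₂ j) r → Halts (suc n) q t₁ i t₂ j r
    by-wipe : ∀ {n q t₁ i t₂ j r q′} → act q (t₁ i) (t₂ j) ≡ wipe q′ →
      Halts n q′ t₁ i (λ _ → blank₂) 0 r → Halts (suc n) q t₁ i t₂ j r

  Halts-weaken : ∀ {m n q t₁ i t₂ j r} → m ≤ n → Halts m q t₁ i t₂ j r → Halts n q t₁ i t₂ j r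
  Halts-weaken (s≤s p) (by-halt e)   = by-halt e
  Halts-weaken (s≤s p) (by-go e h)   = by-go e (Halts-weaken p h)
  Halts-weaken (s≤s p) (by-wipe e h) = by-wipe e (Halts-weaken p h)

  Halts-cong : ∀ {n q t₁ t₁′ i t₂ t₂′ j r} → t₁ ≗ t₁′ → t₂ ≗ t₂′ → Halts n q t₁ i t₂ j r → Halts n q t₁′ i t₂′ j r
  Halts-cong {q = q} {i = i} {j = j} p₁ p₂ (by-halt e) =
    by-halt (trans (sym (cong₂ (act q) (p₁ i) (p₂ j))) e)
  Halts-cong {q = q} {i = i} {j = j} p₁ p₂ (by-go {w₁ = w₁} {w₂ = w₂} e h) =
    by-go (trans (sym (cong₂ (act q) (p₁ i) (p₂ j))) e)
      (Halts-cong (overwrite-cong p₁ i w₁) (overwrite-cong p₂ j w₂) h)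
  Halts-cong {q = q} {i = i} {j = j} p₁ p₂ (by-wipe e h) =
    by-wipe (trans (sym (cong₂ (act q) (p₁ i) (p₂ j))) e) (Halts-cong p₁ (λ _ → refl) h)

-- Compilation into oracle Turing machines

module Compile {a : ℕ} (X : Machine a) where
  open Machine X

  Control : Set
  Control = Q ⊎ Bool ⊎ Bool

  Control-finite : Finite Control
  Control-finite = ⊎-finite Q-finite (⊎-finite Bool-finite Bool-finite)

  pattern at q        = inj₁ q
  pattern halted r    = inj₂ (inj₁ r)
  pattern wiping      = inj₂ (inj₂ false)
  pattern returning   = inj₂ (inj₂ true)

  -- A query always leads to the same state of the compiled machine, so the state to
  -- resume in is left as a note in the current cell of tape 1.
  Work : Set
  Work = C₁ ⊎ C₂ ⊎ (C₁ × Q)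

  Work-finite : Finite Work
  Work-finite = ⊎-finite C₁-finite (⊎-finite C₂-finite (×-finite C₁-finite Q-finite))

  private
    module K = Finite Control-finite
    module W = Finite Work-finite

  Cell : Set
  Cell = Γ a 0 W.size

  symbol : Work → Cell
  symbol x = just (inj₂ (inj₂ (W.enc x)))

  view₁ : Work → C₁
  view₁ (inj₁ c) = c
  view₁ (inj₂ _) = raw nothing

  dec₁ : Cell → C₁
  dec₁ nothing                = raw nothing
  dec₁ (just (inj₁ x))        = raw (just x)
  dec₁ (just (inj₂ (inj₂ k))) = view₁ (W.dec k)

  view₂ : Work → C₂
  view₂ (inj₂ (inj₁ c)) = c
  view₂ _               = blank₂

  dec₂ : Cell → C₂
  dec₂ (just (inj₂ (inj₂ k))) = view₂ (W.dec k)
  dec₂ _                      = blank₂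

  view-note : Work → Maybe (C₁ × Q)
  view-note (inj₂ (inj₂ n)) = just n
  view-note _               = nothing

  dec-note : Cell → Maybe (C₁ × Q)
  dec-note (just (inj₂ (inj₂ k))) = view-note (W.dec k)
  dec-note _                      = nothing

  enc₁ : Cell → Maybe C₁ → Cell
  enc₁ g nothing  = g
  enc₁ g (just c) = symbol (inj₁ c)

  enc₂ : Cell → Maybe C₂ → Cell
  enc₂ g nothing  = g
  enc₂ g (just c) = symbol (inj₂ (inj₁ c))

  Next : Set
  Next = Fin K.size × Cell × Move × Cell × Move

  perform : Action Q C₁ C₂ → Cell → Cell → Next
  perform (go q w₁ d₁ w₂ d₂) g₁ g₂ = K.enc (at q) , enc₁ g₁ w₁ , d₁ , enc₂ g₂ w₂ , d₂
  perform (wipe q)           g₁ g₂ = K.enc wiping , symbol (inj₂ (inj₂ (dec₁ g₁ , q))) , S , g₂ , S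
  perform (halt r)           g₁ g₂ = K.enc (halted r) , g₁ , S , g₂ , S

  resume : Maybe (C₁ × Q) → Cell → Cell → Next
  resume (just (c , q)) g₁ g₂ = K.enc (at q) , symbol (inj₁ c) , S , g₂ , S
  resume nothing        g₁ g₂ = K.enc (halted false) , g₁ , S , g₂ , S

  -- `step` intercepts the halted states and `wiping` before it consults this function, so the
  -- second clause acts in `returning`.
  transition : Control → Cell → Cell → Next
  transition (at q)  g₁ g₂ = perform (act q (dec₁ g₁) (dec₂ g₂)) g₁ g₂
  transition (inj₂ _) g₁ g₂ = resume (dec-note g₁) g₁ g₂

  -- `wiping` is the query state, and both answers lead to `returning`, where the note tells in
  -- which state to go on.
  otm : OTM a 0
  otm = record
    { nstates = K.size ; nwork = W.size
    ; start = K.enc (at start) ; accept = K.enc (halted true) ; reject = K.enc (halted false)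
    ; query = K.enc wiping ; qyes = K.enc returning ; qno = K.enc returning
    ; δ = λ s → transition (K.dec s) }

  private
    Tapes : Set
    Tapes = Tape otm

    read : Tapes → ℕ → Cell
    read = readCell otm

    after : Next → Tapes → ℕ → Tapes → ℕ → Config otm
    after (s , w₁ , d₁ , w₂ , d₂) mt i ot j =
      conf s (write otm mt i w₁) (move otm d₁ i) (write otm ot j w₂) (move otm d₂ j)

  kind-at : ∀ q → kind otm (K.enc (at q)) ≡ working
  kind-at q rewrite K.enc-≢ {at q} {halted true} (λ ()) | K.enc-≢ {at q} {halted false} (λ ())
                  | K.enc-≢ {at q} {wiping} (λ ()) = refl

  kind-returning : kind otm (K.enc returning) ≡ working
  kind-returning rewrite K.enc-≢ {returning} {halted true} (λ ()) | K.enc-≢ {returning} {halted false} (λ ())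
                       | K.enc-≢ {returning} {wiping} (λ ()) = refl

  kind-wiping : kind otm (K.enc wiping) ≡ asking
  kind-wiping rewrite K.enc-≢ {wiping} {halted true} (λ ()) | K.enc-≢ {wiping} {halted false} (λ ())
                    | dec-true (K.enc wiping ≟ K.enc wiping) refl = refl

  kind-halted : ∀ r → kind otm (K.enc (halted r)) ≡ halting r
  kind-halted true rewrite dec-true (K.enc (halted true) ≟ K.enc (halted true)) refl = refl
  kind-halted false rewrite K.enc-≢ {halted false} {halted true} (λ ())
                          | dec-true (K.enc (halted false) ≟ K.enc (halted false)) refl = refl

  step-control : ∀ σ mt i ot j → kind otm (K.enc σ) ≡ working →
    step otm noOracle (conf (K.enc σ) mt i ot j) ≡ after (transition σ (read mt i) (read ot j)) mt i ot j
  step-control σ mt i ot j e = trans (step-working otm noOracle (K.enc σ) e)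
    (cong (λ τ → after (transition τ (read mt i) (read ot j)) mt i ot j) (K.dec-enc σ))

  dec₁-symbol : ∀ c → dec₁ (symbol (inj₁ c)) ≡ c
  dec₁-symbol c = cong view₁ (W.dec-enc (inj₁ c))

  dec₂-symbol : ∀ c → dec₂ (symbol (inj₂ (inj₁ c))) ≡ c
  dec₂-symbol c = cong view₂ (W.dec-enc (inj₂ (inj₁ c)))

  dec-note-symbol : ∀ n → dec-note (symbol (inj₂ (inj₂ n))) ≡ just n
  dec-note-symbol n = cong view-note (W.dec-enc (inj₂ (inj₂ n)))

  module _ {C : Set} (dec : Cell → C) where
    Represents : Tapes → (ℕ → C) → Set
    Represents t f = ∀ k → dec (read t k) ≡ f k

    represents-write : ∀ t {f} → Represents t f → ∀ i {s c} → dec s ≡ c → Represents (write otm t i s) (upd f i c)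
    represents-write t {f} ρ i {s} {c} e k =
      trans (cong dec (readCell-write otm t i s k)) (pointwise k)
      where
      pointwise : ∀ k → dec (upd (read t) i s k) ≡ upd f i c k
      pointwise k with i ≡ᵇ k
      ... | true  = e
      ... | false = ρ k

    -- A cell that the action leaves alone still has to be written; the compiled machine writes back
    -- the symbol it reads.
    represents-same : ∀ t {f} → Represents t f → ∀ i → Represents (write otm t i (read t i)) f
    represents-same t {f} ρ i k =
      trans (represents-write t ρ i (ρ i) k) (upd-≗ {f = f} {g = f} refl (λ _ _ → refl) k)

  represents-enc₁ : ∀ t {f} → Represents dec₁ t f → ∀ i w →
    Represents dec₁ (write otm t i (enc₁ (read t i) w)) (overwrite f i w)
  represents-enc₁ t ρ i nothing  = represents-same dec₁ t ρ i
  represents-enc₁ t ρ i (just c) = represents-write dec₁ t ρ i (dec₁-symbol c)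

  represents-enc₂ : ∀ t {f} → Represents dec₂ t f → ∀ i w →
    Represents dec₂ (write otm t i (enc₂ (read t i) w)) (overwrite f i w)
  represents-enc₂ t ρ i nothing  = represents-same dec₂ t ρ i
  represents-enc₂ t ρ i (just c) = represents-write dec₂ t ρ i (dec₂-symbol c)

  Decided : ℕ → Config otm → Bool → Set
  Decided T c r = result otm (run otm noOracle T c) ≡ just r

  decided-step : ∀ {T c c′ r} → step otm noOracle c ≡ c′ → Decided T c′ r → Decided (suc T) c r
  decided-step refl d = d

  step-at : ∀ {q t₁ i t₂ j ac} mt ot → Represents dec₁ mt t₁ → Represents dec₂ ot t₂ → act q (t₁ i) (t₂ j) ≡ ac →
    step otm noOracle (conf (K.enc (at q)) mt i ot j) ≡ after (perform ac (read mt i) (read ot j)) mt i ot j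
  step-at {q} {i = i} {j = j} mt ot ρ₁ ρ₂ e = trans (step-control (at q) mt i ot j (kind-at q))
    (cong (λ ac → after (perform ac (read mt i) (read ot j)) mt i ot j) (trans (cong₂ (act q) (ρ₁ i) (ρ₂ j)) e))

  -- The factor 3 pays for a wipe: leave the note, query, restore the cell and resume. Every other
  -- action takes one step, and spare time is spent in the halted state.
  halts⇒decided : ∀ {n q t₁ i t₂ j r} → Halts n q t₁ i t₂ j r →
    ∀ mt ot → Represents dec₁ mt t₁ → Represents dec₂ ot t₂ →
    ∀ {T} → n * 3 ≤ T → Decided T (conf (K.enc (at q)) mt i ot j) r
  halts⇒decided {q = q} {i = i} {j = j} {r} (by-halt e) mt ot ρ₁ ρ₂ (s≤s {n = T} _) =
    decided-step {T}
      (step-at mt ot ρ₁ ρ₂ e)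
      (run-halting otm noOracle T _ (kind-halted r))
  halts⇒decided {q = q} {i = i} {j = j} {r} (by-go {q′ = q′} {w₁} {d₁} {w₂} {d₂} e h) mt ot ρ₁ ρ₂ (s≤s {n = T} p) =
    decided-step {T}
      (step-at mt ot ρ₁ ρ₂ e)
      (subst₂ (λ i′ j′ → Decided T (conf (K.enc (at q′)) (write otm mt i (enc₁ (read mt i) w₁)) i′
                                        (write otm ot j (enc₂ (read ot j) w₂)) j′) r)
        (sym (shift-move otm d₁ i)) (sym (shift-move otm d₂ j))
        (halts⇒decided h _ _ (represents-enc₁ mt ρ₁ i w₁) (represents-enc₂ ot ρ₂ j w₂) (≤-trans (m≤n+m _ 2) p)))
  halts⇒decided {q = q} {t₁} {i} {t₂} {j} {r} (by-wipe {q′ = q′} e h) mt ot ρ₁ ρ₂ (s≤s (s≤s (s≤s {n = T} p))) =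
    decided-step {suc (suc T)}
      (step-at mt ot ρ₁ ρ₂ e)
      (decided-step {suc T} (step-asking otm noOracle (K.enc wiping) kind-wiping)
        (decided-step {T}
          (trans (step-control returning noted i [] 0 kind-returning)
            (cong (λ n → after (resume n (read noted i) nothing) noted i [] 0) note-read))
          (halts⇒decided h _ _ restored (λ { zero → refl ; (suc _) → refl }) p)))
    where
    note : Cell
    note = symbol (inj₂ (inj₂ (dec₁ (read mt i) , q′)))
    noted : Tapes
    noted = write otm mt i note
    note-read : dec-note (read noted i) ≡ just (dec₁ (read mt i) , q′)
    note-read = trans (cong dec-note (trans (readCell-write otm mt i note i) (upd-same (read mt) i)))
                      (dec-note-symbol _)
    -- Under the note the cell may decode to a wrong symbol; the second write puts the old one back.
    restored : Represents dec₁ (write otm noted i (symbol (inj₁ (dec₁ (read mt i))))) t₁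
    restored k = trans (represents-write dec₁ noted (represents-write dec₁ mt ρ₁ i refl) i (dec₁-symbol _) k)
      (upd-≗ {f = upd t₁ i (dec₁ note)} {g = t₁} (sym (ρ₁ i)) (λ j i≢j → sym (upd-other t₁ i≢j)) k)

  halts⇒decides : ∀ {w n r} → Halts n start (λ i → raw (nth w i)) 0 (λ _ → blank₂) 0 r →
    ∀ {T} → n * 3 ≤ T → Decided T (initial otm w) r
  halts⇒decides {w} h p = halts⇒decided h (inputTape otm w) [] input (λ _ → refl) p
    where
    input : Represents dec₁ (inputTape otm w) (λ i → raw (nth w i))
    input k rewrite readCell-input otm w k with nth w k
    ... | just _  = refl
    ... | nothing = refl

-- Answering the queries of MA by runs of MB

≡ᵇ-refl : ∀ n → (n ≡ᵇ n) ≡ true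
≡ᵇ-refl zero    = refl
≡ᵇ-refl (suc n) = ≡ᵇ-refl n

≢⇒≡ᵇ-false : ∀ {m n} → m ≢ n → (m ≡ᵇ n) ≡ false
≢⇒≡ᵇ-false {m} {n} m≢n with m ≡ᵇ n in e
... | false = refl
... | true  = contradiction (≡ᵇ⇒≡ m n (subst T (sym e) _)) m≢n

nth-< : ∀ {A : Set} (t : List A) {i} → i < length t → ∃[ c ] nth t i ≡ just c
nth-< (x ∷ t) {zero}  _       = x , refl
nth-< (x ∷ t) {suc i} (s≤s p) = nth-< t p

nth-≥ : ∀ {A : Set} (t : List A) {i} → length t ≤ i → nth t i ≡ nothing
nth-≥ []      _       = refl
nth-≥ (x ∷ t) (s≤s p) = nth-≥ t p

-- The track `v` after `cs` has been copied onto it from position `k` on.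
splice : ∀ {A : Set} → (ℕ → Maybe A) → ℕ → List A → ℕ → Maybe A
splice v zero    []       j       = v j
splice v zero    (c ∷ cs) zero    = just c
splice v zero    (c ∷ cs) (suc j) = splice (v ∘ suc) zero cs j
splice v (suc k) cs       zero    = v zero
splice v (suc k) cs       (suc j) = splice (v ∘ suc) k cs j

splice-[] : ∀ {A : Set} (v : ℕ → Maybe A) k → splice v k [] ≗ v
splice-[] v zero    j       = refl
splice-[] v (suc k) zero    = refl
splice-[] v (suc k) (suc j) = splice-[] (v ∘ suc) k j

splice-∷ : ∀ {A : Set} (v : ℕ → Maybe A) k c cs → splice (upd v k (just c)) (suc k) cs ≗ splice v k (c ∷ cs)
splice-∷ v zero    c cs zero    = refl
splice-∷ v zero    c cs (suc j) = refl
splice-∷ v (suc k) c cs zero    = refl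
splice-∷ v (suc k) c cs (suc j) = splice-∷ (v ∘ suc) k c cs j

splice-nth : ∀ {A : Set} (cs : List A) → splice (λ _ → nothing) 0 cs ≗ nth cs
splice-nth []       j       = refl
splice-nth (c ∷ cs) zero    = refl
splice-nth (c ∷ cs) (suc j) = splice-nth cs j

module _ (N V : ℕ) where
  -- In order: marking the cell, `rewind`, `copy`, `rewindB`, `simB`, `sweepR`, `sweepL` and `find`,
  -- then `n` for the rest. `N` bounds the query word and the heads of `MA`, `V` the time of `MB`.
  query-cost : ℕ → ℕ
  query-cost n = suc (suc N + (suc N + (suc N + (suc V + (suc (N + V) + (suc (N + V) + (suc N + n)))))))

  time : ℕ → ℕ
  time zero    = 1
  time (suc k) = query-cost (time k)

  suc-time≤ : ∀ k → suc (time k) ≤ time (suc k)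
  suc-time≤ k = s≤s (past N (past N (past N (past V (past (N + V) (past (N + V) (past N ≤-refl)))))))
    where
    past : ∀ m {x y} → x ≤ y → x ≤ suc m + y
    past m p = ≤-trans p (m≤n+m _ (suc m))

  time-positive : ∀ k → 1 ≤ time k
  time-positive zero    = s≤s z≤n
  time-positive (suc k) = s≤s z≤n

-- The simulating machine

module Simulator {a b : ℕ} (MA : OTM a b) (MB : OTM b 0) where
  private
    module A = OTM MA
    module B = OTM MB
    ΓA ΓB : Set
    ΓA = Γ a b A.nwork
    ΓB = Γ b 0 B.nwork

  -- A query leaves `simA` and passes through `rewind`, `copy`, `rewindB`, `simB`, `sweepR`,
  -- `sweepL` and `find` before `simA` resumes. The Boolean of the last three is the answer of `MB`,
  -- carried along during the cleaning.
  data Phase : Set where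
    init rewind copy rewindB : Phase
    simA               : Fin A.nstates → Phase
    simB               : Fin B.nstates → Phase
    sweepR sweepL find : Bool → Phase

  Phase-finite : Finite Phase
  Phase-finite = retract-finite f g gf
      (⊎-finite (Fin-finite 4) (⊎-finite (Fin-finite _) (⊎-finite (Fin-finite _) (×-finite (Fin-finite 3) Bool-finite))))
    where
    Code : Set
    Code = Fin 4 ⊎ Fin A.nstates ⊎ Fin B.nstates ⊎ Fin 3 × Bool
    pattern 0F = Fin.zero
    pattern 1F = Fin.suc 0F
    pattern 2F = Fin.suc 1F
    pattern 3F = Fin.suc 2F
    f : Phase → Code
    f init       = inj₁ 0F
    f rewind     = inj₁ 1F
    f copy       = inj₁ 2F
    f rewindB    = inj₁ 3F
    f (simA s)   = inj₂ (inj₁ s)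
    f (simB s)   = inj₂ (inj₂ (inj₁ s))
    f (sweepR r) = inj₂ (inj₂ (inj₂ (0F , r)))
    f (sweepL r) = inj₂ (inj₂ (inj₂ (1F , r)))
    f (find r)   = inj₂ (inj₂ (inj₂ (2F , r)))
    g : Code → Phase
    g (inj₁ 0F) = init
    g (inj₁ 1F) = rewind
    g (inj₁ 2F) = copy
    g (inj₁ 3F) = rewindB
    g (inj₂ (inj₁ s)) = simA s
    g (inj₂ (inj₂ (inj₁ s))) = simB s
    g (inj₂ (inj₂ (inj₂ (0F , r)))) = sweepR r
    g (inj₂ (inj₂ (inj₂ (1F , r)))) = sweepL r
    g (inj₂ (inj₂ (inj₂ (2F , r)))) = find r
    gf : ∀ q → g (f q) ≡ q
    gf init       = refl
    gf rewind     = refl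
    gf copy       = refl
    gf rewindB    = refl
    gf (simA s)   = refl
    gf (simB s)   = refl
    gf (sweepR r) = refl
    gf (sweepL r) = refl
    gf (find r)   = refl

  -- Tape 1 carries the main tapes of both machines (symB is nothing on the cells MB
  -- has not visited during the current query); tape 2 carries both oracle tapes.
  record Cell₁ : Set where
    constructor cell₁
    field
      first mark : Bool
      symA       : ΓA
      symB       : Maybe ΓB

  record Cell₂ : Set where
    constructor cell₂
    field
      first : Bool
      symA  : ΓA
      symB  : ΓB

  Γ-finite : ∀ k l m → Finite (Γ k l m)
  Γ-finite k l m = Maybe-finite (⊎-finite (Fin-finite k) (⊎-finite (Fin-finite l) (Fin-finite m)))

  Cell₁-finite : Finite Cell₁
  Cell₁-finite = retract-finite (λ (cell₁ f m x y) → f , m , x , y) (λ (f , m , x , y) → cell₁ f m x y) (λ _ → refl)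
    (×-finite Bool-finite (×-finite Bool-finite (×-finite (Γ-finite _ _ _) (Maybe-finite (Γ-finite _ _ _)))))

  Cell₂-finite : Finite Cell₂
  Cell₂-finite = retract-finite (λ (cell₂ f x y) → f , x , y) (λ (f , x , y) → cell₂ f x y) (λ _ → refl)
    (×-finite Bool-finite (×-finite (Γ-finite _ _ _) (Γ-finite _ _ _)))

  Act : Set
  Act = Action Phase Cell₁ Cell₂

  actA : Kind MA → Fin A.nstates → Cell₁ → Cell₂ → Act
  actA (halting r) s c₁ c₂ = halt r
  -- The mark saves the position of the main head of `MA`; its oracle head returns to 0 after a
  -- query anyway.
  actA asking      s (cell₁ f _ x y) c₂ = go rewind (just (cell₁ f true x y)) S nothing S
  actA working     s (cell₁ f m x y) (cell₂ f′ x′ y′) =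
    let s′ , wm , dm , wo , dO = A.δ s x x′ in
    go (simA s′) (just (cell₁ f m wm y)) dm (just (cell₂ f′ wo y′)) dO

  actB : Kind MB → Fin B.nstates → Cell₁ → Cell₂ → Act
  actB (halting r) s c₁ c₂ = wipe (sweepR r)
  -- `MB` runs with the void oracle, so each query is answered no; the wipe reproduces its effect on
  -- the oracle tape.
  actB asking      s c₁ c₂ = wipe (simB B.qno)
  actB working     s (cell₁ f m x y) (cell₂ f′ x′ y′) =
    let s′ , wm , dm , wo , dO = B.δ s (fromMaybe nothing y) y′ in
    go (simB s′) (just (cell₁ f m x (just wm))) dm (just (cell₂ f′ x′ wo)) dO

  actCopy : Cell₁ → Cell₂ → Act
  actCopy (cell₁ f m x y) (cell₂ _ (just (inj₂ (inj₁ c))) _) = go copy (just (cell₁ f m x (just (just (inj₁ c))))) R nothing R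
  actCopy _               _                                  = go rewindB nothing S nothing S

  act : Phase → Cell₁ → Cell₂ → Act
  act init (cell₁ _ m x y) (cell₂ _ x′ y′) =
    go (simA A.start) (just (cell₁ true m x y)) S (just (cell₂ true x′ y′)) S
  act (simA s) = actA (kind MA s) s
  act rewind (cell₁ f _ _ _) (cell₂ f′ _ _) =
    -- A head at the left end stays there under `L`, so both move until both see the flag `first`.
    if f ∧ f′ then go copy nothing S nothing S else go rewind nothing L nothing L
  act copy = actCopy
  -- The query word is on tape 1 by now, and the wipe hands `MB` a blank oracle tape.
  act rewindB (cell₁ f _ _ _) _ = if f then wipe (simB B.start) else go rewindB nothing L nothing S
  act (simB s) = actB (kind MB s) s
  -- `MB` may stop anywhere among the cells it visited; the head first goes past them all so that
  -- `sweepL` erases every one.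
  act (sweepR r) (cell₁ _ _ _ (just _)) _ = go (sweepR r) nothing R nothing S
  act (sweepR r) (cell₁ _ _ _ nothing)  _ = go (sweepL r) nothing L nothing S
  act (sweepL r) (cell₁ f m x _) _ =
    go (if f then find r else sweepL r) (just (cell₁ f m x nothing)) (if f then S else L) nothing S
  act (find r) (cell₁ f m x y) (cell₂ _ x′ y′) =
    -- The wipe removed the flag at the left end of tape 2, whose head still stands there; it is set
    -- again.
    if m then go (simA (if r then A.qyes else A.qno)) (just (cell₁ f false x y)) S (just (cell₂ true x′ y′)) S
         else go (find r) nothing R nothing S

  simulator : Machine a
  simulator = record
    { Q = Phase ; C₁ = Cell₁ ; C₂ = Cell₂
    ; Q-finite = Phase-finite ; C₁-finite = Cell₁-finite ; C₂-finite = Cell₂-finite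
    ; raw = λ x → cell₁ false false (Maybe.map inj₁ x) nothing
    ; blank₂ = cell₂ false nothing nothing
    ; start = init
    ; act = act }

  open Machine simulator using (Halts; by-halt; by-go; by-wipe; Halts-weaken; Halts-cong)

  lay₁ : (ℕ → Bool) → (ℕ → ΓA) → (ℕ → Maybe ΓB) → ℕ → Cell₁
  lay₁ μ u v i = cell₁ (i ≡ᵇ 0) (μ i) (u i) (v i)

  lay₂ : (ℕ → ΓA) → ℕ → Cell₂
  lay₂ u i = cell₂ (i ≡ᵇ 0) (u i) nothing

  -- The flag `first` is false even at position 0, since `MB` runs on a wiped tape.
  lay₂B : (ℕ → ΓB) → ℕ → Cell₂
  lay₂B u i = cell₂ false nothing (u i)

  unmarked : ℕ → Bool
  unmarked _ = false

  clean : ℕ → Maybe ΓB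
  clean _ = nothing

  empty₂ : ℕ → Cell₂
  empty₂ _ = cell₂ false nothing nothing

  lay₁-upd : ∀ {μ u v μ′ u′ v′ x y z} i → μ′ ≗ upd μ i x → u′ ≗ upd u i y → v′ ≗ upd v i z →
    upd (lay₁ μ u v) i (cell₁ (i ≡ᵇ 0) x y z) ≗ lay₁ μ′ u′ v′
  lay₁-upd {μ} {u} {v} {μ′} {u′} {v′} {x} {y} {z} i p q r j
    rewrite p j | q j | r j = pointwise j
    where
    pointwise : upd (lay₁ μ u v) i (cell₁ (i ≡ᵇ 0) x y z) ≗ lay₁ (upd μ i x) (upd u i y) (upd v i z)
    pointwise j with i ≡ᵇ j in e
    ... | false = refl
    ... | true  rewrite ≡ᵇ⇒≡ i j (subst T (sym e) _) = refl

  upd-self : ∀ {C : Set} (f : ℕ → C) i → f ≗ upd f i (f i)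
  upd-self f i j = sym (upd-≗ {f = f} {g = f} refl (λ _ _ → refl) j)

  -- Budgets of the phases of a query

  module _ {r : Bool} where
    rewind-halts : ∀ {n μ u v w} k i j → i ≤ k → j ≤ k →
      Halts n copy (lay₁ μ u v) 0 (lay₂ w) 0 r → Halts (suc k + n) rewind (lay₁ μ u v) i (lay₂ w) j r
    rewind-halts k zero zero _ _ h = Halts-weaken (s≤s (m≤n+m _ k)) (by-go refl h)
    rewind-halts (suc k) zero    (suc j) _       (s≤s q) h = by-go refl (rewind-halts k 0 j z≤n q h)
    rewind-halts (suc k) (suc i) zero    (s≤s p) _       h = by-go refl (rewind-halts k i 0 p z≤n h)
    rewind-halts (suc k) (suc i) (suc j) (s≤s p) (s≤s q) h = by-go refl (rewind-halts k i j p q h)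

    copy-stop : ∀ {n μ u w} v k {x} → w k ≡ x →
      (∀ {c} → actCopy c (cell₂ (k ≡ᵇ 0) x nothing) ≡ go rewindB nothing S nothing S) →
      Halts n rewindB (lay₁ μ u (splice v k [])) k (lay₂ w) k r → Halts (suc n) copy (lay₁ μ u v) k (lay₂ w) k r
    copy-stop {μ = μ} {u} v k e stops h = by-go
      (trans (cong (λ x → actCopy (lay₁ μ u v k) (cell₂ (k ≡ᵇ 0) x nothing)) e) stops)
      (Halts-cong (λ j → cong (cell₁ (j ≡ᵇ 0) (μ j) (u j)) (splice-[] v k j)) (λ _ → refl) h)

    -- `actCopy` stops at the same symbols as `queryWord`, so the recursion follows `t`; `v`
    -- accumulates the letters copied so far.
    copy-halts : ∀ {n μ u w} (t : Tape MA) v k → (∀ j → w (j + k) ≡ readCell MA t j) →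
      let q = queryWord MA t in
      Halts n rewindB (lay₁ μ u (splice v k (inputTape MB q))) (length q + k) (lay₂ w) (length q + k) r →
      Halts (suc (length q) + n) copy (lay₁ μ u v) k (lay₂ w) k r
    copy-halts []                        v k reads h = copy-stop v k (reads 0) refl h
    copy-halts (nothing ∷ _)             v k reads h = copy-stop v k (reads 0) refl h
    copy-halts (just (inj₁ _) ∷ _)       v k reads h = copy-stop v k (reads 0) refl h
    copy-halts (just (inj₂ (inj₂ _)) ∷ _) v k reads h = copy-stop v k (reads 0) refl h
    copy-halts {n} {μ} {u} {w} (just (inj₂ (inj₁ c)) ∷ t) v k reads h = by-go
      (cong (λ x → actCopy (lay₁ μ u v k) (cell₂ (k ≡ᵇ 0) x nothing)) (reads 0))
      (Halts-cong
        (λ j → sym (lay₁-upd {v = v} k (upd-self μ k) (upd-self u k) (λ _ → refl) j)) (λ _ → refl)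
        (copy-halts t (upd v k (just (just (inj₁ c)))) (suc k)
          (λ j → trans (cong w (+-suc j k)) (reads (suc j)))
          (Halts-cong (λ j → cong (cell₁ (j ≡ᵇ 0) (μ j) (u j)) (sym (splice-∷ v k (just (inj₁ c)) word j))) (λ _ → refl)
            (subst (λ p → Halts n rewindB (lay₁ μ u (splice v k (just (inj₁ c) ∷ word))) p (lay₂ w) p r)
              (sym (+-suc (length (queryWord MA t)) k)) h))))
      where
      word : Tape MB
      word = inputTape MB (queryWord MA t)

    rewindB-halts : ∀ {n μ u v t₂ j} i →
      Halts n (simB B.start) (lay₁ μ u v) 0 empty₂ 0 r → Halts (suc i + n) rewindB (lay₁ μ u v) i t₂ j r
    rewindB-halts zero    h = by-wipe refl h
    rewindB-halts (suc i) h = by-go refl (rewindB-halts i h)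

    -- The visited cells are the initial segment `t`, so the sweep turns at position `length t`,
    -- with `d` cells to go. If `t` is empty, `L` leaves the head on cell 0.
    sweepR-halts : ∀ {n μ u t₂ j s} (t : Tape MB) d i → d + i ≡ length t →
      Halts n (sweepL s) (lay₁ μ u (nth t)) (length t ∸ 1) t₂ j r →
      Halts (suc d + n) (sweepR s) (lay₁ μ u (nth t)) i t₂ j r
    sweepR-halts {μ = μ} {u} {t₂} {j} {s} t zero    i refl h = by-go
      (cong (λ x → act (sweepR s) (cell₁ (i ≡ᵇ 0) (μ i) (u i) x) (t₂ j)) (nth-≥ t ≤-refl)) h
    sweepR-halts {μ = μ} {u} {t₂} {j} {s} t (suc d) i e h
      with nth t i in nth-i | nth-< t (≤-trans (s≤s (m≤n+m i d)) (≤-reflexive e))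
    ... | just c | _ = by-go (cong (λ x → act (sweepR s) (cell₁ (i ≡ᵇ 0) (μ i) (u i) x) (t₂ j)) nth-i)
                         (sweepR-halts t d (suc i) (trans (+-suc d i) e) h)

    sweepL-halts : ∀ {n μ u t₂ j s} i v → (∀ k → i < k → v k ≡ nothing) →
      Halts n (find s) (lay₁ μ u clean) 0 t₂ j r → Halts (suc i + n) (sweepL s) (lay₁ μ u v) i t₂ j r
    sweepL-halts {μ = μ} {u} zero v beyond h = by-go refl
      (Halts-cong (λ j → sym (lay₁-upd 0 (upd-self μ 0) (upd-self u 0) erased j)) (λ _ → refl) h)
      where
      erased : clean ≗ upd v 0 nothing
      erased zero    = refl
      erased (suc k) = sym (beyond (suc k) (s≤s z≤n))
    sweepL-halts {μ = μ} {u} (suc i) v beyond h = by-go refl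
      (Halts-cong (λ j → sym (lay₁-upd {v = v} (suc i) (upd-self μ (suc i)) (upd-self u (suc i)) (λ _ → refl) j)) (λ _ → refl)
        (sweepL-halts i (upd v (suc i) nothing) still h))
      where
      still : ∀ k → i < k → upd v (suc i) nothing k ≡ nothing
      still k i<k with suc i Data.Nat.≟ k
      ... | yes refl = upd-same v (suc i)
      ... | no i≢k   = trans (upd-other v i≢k) (beyond k (≤∧≢⇒< i<k i≢k))

    find-halts : ∀ {n u h s} d i → d + i ≡ h →
      Halts n (simA (if s then A.qyes else A.qno)) (lay₁ unmarked u clean) h (lay₂ (readCell MA [])) 0 r →
      Halts (suc d + n) (find s) (lay₁ (h ≡ᵇ_) u clean) i empty₂ 0 r
    find-halts {u = u} {s = s} zero i refl k = by-go
      (cong (λ m → act (find s) (cell₁ (i ≡ᵇ 0) m (u i) nothing) (cell₂ false nothing nothing)) (≡ᵇ-refl i))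
      (Halts-cong (λ j → sym (lay₁-upd i unmark (upd-self u i) (upd-self clean i) j))
                  (λ { zero → refl ; (suc _) → refl }) k)
      where
      unmark : unmarked ≗ upd (i ≡ᵇ_) i false
      unmark j with i ≡ᵇ j
      ... | true  = refl
      ... | false = refl
    find-halts {u = u} {s = s} (suc d) i refl k = by-go
      (cong (λ m → act (find s) (cell₁ (i ≡ᵇ 0) m (u i) nothing) (cell₂ false nothing nothing))
        (≢⇒≡ᵇ-false (λ e → <⇒≢ (s≤s (m≤n+m i d)) (sym e))))
      (find-halts d (suc i) (+-suc d i) k)

    -- Two invariants are carried. The head never lies beyond `length t`, so each write extends `t`
    -- without a gap; and each step adds at most one cell, so `length t + k ≤ m` bounds the region
    -- to be swept.
    simB-halts : ∀ {n μ u m s} k q t i t₂ j → result MB (run MB noOracle k (conf q t i t₂ j)) ≡ just s →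
      i ≤ length t → length t + k ≤ m →
      (∀ t i → i ≤ length t → length t ≤ m → Halts n (sweepR s) (lay₁ μ u (nth t)) i empty₂ 0 r) →
      Halts (suc k + n) (simB q) (lay₁ μ u (nth t)) i (lay₂B (readCell MB t₂)) j r
    simB-halts k q t i t₂ j res i≤ len h with kind MB q in κ
    simB-halts {μ = μ} {u} k q t i t₂ j res i≤ len h | halting s′
      with refl ← just-injective (trans (sym (run-halting MB noOracle k (conf q t i t₂ j) κ)) res)
      = Halts-weaken (s≤s (m≤n+m _ k))
          (by-wipe (cong (λ κ → actB κ q (lay₁ μ u (nth t) i) (lay₂B (readCell MB t₂) j)) κ)
            (h t i i≤ (≤-trans (m≤m+n _ k) len)))
    simB-halts zero q t i t₂ j res i≤ len h | asking
      with () ← trans (sym κ) (result-just MB (conf q t i t₂ j) res)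
    simB-halts zero q t i t₂ j res i≤ len h | working
      with () ← trans (sym κ) (result-just MB (conf q t i t₂ j) res)
    simB-halts {μ = μ} {u} (suc k) q t i t₂ j res i≤ len h | asking =
      by-wipe (cong (λ κ → actB κ q (lay₁ μ u (nth t) i) (lay₂B (readCell MB t₂) j)) κ)
        (simB-halts k B.qno t i [] 0
          (subst (λ c → result MB (run MB noOracle k c) ≡ just _) (step-asking MB noOracle q κ) res)
          i≤ (≤-trans (+-monoʳ-≤ (length t) (n≤1+n k)) len) h)
    simB-halts {μ = μ} {u} {m} (suc k) q t i t₂ j res i≤ len h | working =
      by-go
        (trans (cong (λ κ → actB κ q (lay₁ μ u (nth t) i) (lay₂B (readCell MB t₂) j)) κ)
          (cong (λ x → perform (B.δ q x (readCell MB t₂ j))) (sym (readCell-nth MB t i))))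
        (Halts-cong
          (λ j → sym (lay₁-upd {v = nth t} i (upd-self μ i) (upd-self u i) (nth-write MB t i wm i≤) j))
          written₂
          (subst₂ (λ i′ j′ → Halts _ (simB q′) (lay₁ μ u (nth (write MB t i wm))) i′
                                   (lay₂B (readCell MB (write MB t₂ j wo))) j′ r)
            (shift-move MB dm i) (shift-move MB dO j)
            (simB-halts k q′ (write MB t i wm) (move MB dm i) (write MB t₂ j wo) (move MB dO j)
              (subst (λ c → result MB (run MB noOracle k c) ≡ just _) (step-working MB noOracle q κ) res)
              (≤-trans (move≤ MB dm i) (length-write> MB t i wm))
              (≤-trans (+-monoˡ-≤ k (length-write≤ MB t i wm (n≤1+n _) (s≤s i≤)))
                (≤-trans (≤-reflexive (sym (+-suc (length t) k))) len))
              h)))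
      where
      next : Fin B.nstates × ΓB × Move × ΓB × Move
      next = B.δ q (readCell MB t i) (readCell MB t₂ j)
      q′ : Fin B.nstates
      q′ = proj₁ next
      wm wo : ΓB
      wm = proj₁ (proj₂ next)
      wo = proj₁ (proj₂ (proj₂ (proj₂ next)))
      dm dO : Move
      dm = proj₁ (proj₂ (proj₂ next))
      dO = proj₂ (proj₂ (proj₂ (proj₂ next)))
      perform : Fin B.nstates × ΓB × Move × ΓB × Move → Act
      perform (s′ , wm , dm , wo , dO) =
        go (simB s′) (just (cell₁ (i ≡ᵇ 0) (μ i) (u i) (just wm))) dm (just (cell₂ false nothing wo)) dO
      written₂ : lay₂B (readCell MB (write MB t₂ j wo)) ≗ upd (lay₂B (readCell MB t₂)) j (cell₂ false nothing wo)
      written₂ k rewrite readCell-write MB t₂ j wo k with j ≡ᵇ k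
      ... | true  = refl
      ... | false = refl

  -- Answering one query and simulating the whole run of `MA`

  module _ (Bs : Lang b) (tB : ℕ → ℕ) (decB : DecidesIn MB noOracle Bs tB)
           (N V : ℕ) (tB≤V : ∀ l → l ≤ N → tB l ≤ V) {r : Bool} where

    query-halts : ∀ {n} q t i t₂ j → kind MA q ≡ asking → i ≤ N → j ≤ N → length t₂ ≤ N →
      Halts n (simA (if Bs (queryWord MA t₂) then A.qyes else A.qno))
        (lay₁ unmarked (readCell MA t) clean) i (lay₂ (readCell MA [])) 0 r →
      Halts (query-cost N V n) (simA q) (lay₁ unmarked (readCell MA t) clean) i (lay₂ (readCell MA t₂)) j r
    query-halts {n} q t i t₂ j κ i≤N j≤N t₂≤N h =
      by-go (cong (λ κ → actA κ q (lay₁ unmarked u clean i) (lay₂ (readCell MA t₂) j)) κ)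
        (Halts-cong (λ j → sym (lay₁-upd i marked (upd-self u i) (upd-self clean i) j)) (λ _ → refl)
          (rewind-halts N i j i≤N j≤N
            (Halts-weaken (+-monoˡ-≤ _ (s≤s word≤N))
              (copy-halts t₂ clean 0 (λ j → cong (readCell MA t₂) (+-identityʳ j))
                (Halts-weaken (+-monoˡ-≤ _ (s≤s (≤-trans (≤-reflexive (+-identityʳ (length word))) word≤N)))
                  (rewindB-halts (length word + 0)
                    -- The track of `MB` was clean before the copying, so it now holds exactly the
                    -- input tape of `MB`.
                    (Halts-cong (λ j → cong (cell₁ (j ≡ᵇ 0) (i ≡ᵇ j) (u j)) (sym (splice-nth (inputTape MB word) j))) (λ _ → refl)
                      (Halts-weaken (+-monoˡ-≤ _ (s≤s (tB≤V (length word) word≤N)))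
                        (simB-halts (tB (length word)) B.start (inputTape MB word) 0 [] 0 (decB word) z≤n
                          (+-mono-≤ (≤-trans (≤-reflexive (length-map _ word)) word≤N) (tB≤V (length word) word≤N))
                          return)))))))))
      where
      u : ℕ → ΓA
      u = readCell MA t
      word : List (Fin b)
      word = queryWord MA t₂
      word≤N : length word ≤ N
      word≤N = ≤-trans (length-queryWord MA t₂) t₂≤N
      marked : (i ≡ᵇ_) ≗ upd unmarked i true
      marked j with i ≡ᵇ j
      ... | true  = refl
      ... | false = refl
      return : ∀ t′ k → k ≤ length t′ → length t′ ≤ N + V →
        Halts (suc (N + V) + (suc (N + V) + (suc N + n))) (sweepR (Bs word)) (lay₁ (i ≡ᵇ_) u (nth t′)) k empty₂ 0 r
      return t′ k k≤ len =
        Halts-weaken (+-monoˡ-≤ _ (s≤s (≤-trans (m∸n≤m (length t′) k) len)))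
          (sweepR-halts t′ (length t′ ∸ k) k (m∸n+n≡m k≤)
            (Halts-weaken (+-monoˡ-≤ _ (s≤s (≤-trans (m∸n≤m (length t′) 1) len)))
              (sweepL-halts (length t′ ∸ 1) (nth t′) (λ k p → nth-≥ t′ (≤-trans (m≤n+m∸n (length t′) 1) p))
                (Halts-weaken (+-monoˡ-≤ n (s≤s i≤N)) (find-halts i 0 (+-identityʳ i) h)))))

    -- With `k` steps left, neither a head nor the end of the oracle tape can get past `N`; hence
    -- every query word has length at most `N`. After a query, oracle head and tape start afresh,
    -- and `k ≤ N` restores their bounds.
    simA-halts : ∀ k q t i t₂ j → result MA (run MA Bs k (conf q t i t₂ j)) ≡ just r →
      i + k ≤ N → j + k ≤ N → length t₂ + k ≤ N →
      Halts (time N V k) (simA q) (lay₁ unmarked (readCell MA t) clean) i (lay₂ (readCell MA t₂)) j r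
    simA-halts k q t i t₂ j res i≤ j≤ len with kind MA q in κ
    simA-halts k q t i t₂ j res i≤ j≤ len | halting s′
      with refl ← just-injective (trans (sym (run-halting MA Bs k (conf q t i t₂ j) κ)) res)
      = Halts-weaken (time-positive N V k)
          (by-halt (cong (λ κ → actA κ q (lay₁ unmarked (readCell MA t) clean i) (lay₂ (readCell MA t₂) j)) κ))
    simA-halts zero q t i t₂ j res i≤ j≤ len | asking
      with () ← trans (sym κ) (result-just MA (conf q t i t₂ j) res)
    simA-halts zero q t i t₂ j res i≤ j≤ len | working
      with () ← trans (sym κ) (result-just MA (conf q t i t₂ j) res)
    simA-halts (suc k) q t i t₂ j res i≤ j≤ len | asking =
      query-halts q t i t₂ j κ (≤-trans (m≤m+n i _) i≤) (≤-trans (m≤m+n j _) j≤) (≤-trans (m≤m+n _ _) len)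
        (simA-halts k _ t i [] 0
          (subst (λ c → result MA (run MA Bs k c) ≡ just r) (step-asking MA Bs q κ) res)
          (≤-trans (+-monoʳ-≤ i (n≤1+n k)) i≤) k≤N k≤N)
      where
      k≤N : k ≤ N
      k≤N = ≤-trans (≤-trans (n≤1+n k) (m≤n+m (suc k) i)) i≤
    simA-halts (suc k) q t i t₂ j res i≤ j≤ len | working =
      Halts-weaken (suc-time≤ N V k) (by-go
        (cong (λ κ → actA κ q (lay₁ unmarked (readCell MA t) clean i) (lay₂ (readCell MA t₂) j)) κ)
        (Halts-cong
          (λ j → sym (lay₁-upd i (upd-self unmarked i) (readCell-write MA t i wm) (upd-self clean i) j))
          written₂
          (subst₂ (λ i′ j′ → Halts (time N V k) (simA q′) (lay₁ unmarked (readCell MA (write MA t i wm)) clean) i′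
                                   (lay₂ (readCell MA (write MA t₂ j wo))) j′ r)
            (shift-move MA dm i) (shift-move MA dO j)
            (simA-halts k q′ (write MA t i wm) (move MA dm i) (write MA t₂ j wo) (move MA dO j)
              (subst (λ c → result MA (run MA Bs k c) ≡ just r) (step-working MA Bs q κ) res)
              (one-step (move≤ MA dm i) i≤) (one-step (move≤ MA dO j) j≤)
              written-length))))
      where
      next : Fin A.nstates × ΓA × Move × ΓA × Move
      next = A.δ q (readCell MA t i) (readCell MA t₂ j)
      q′ : Fin A.nstates
      q′ = proj₁ next
      wm wo : ΓA
      wm = proj₁ (proj₂ next)
      wo = proj₁ (proj₂ (proj₂ (proj₂ next)))
      dm dO : Move
      dm = proj₁ (proj₂ (proj₂ next))
      dO = proj₂ (proj₂ (proj₂ (proj₂ next)))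
      one-step : ∀ {x y} → x ≤ suc y → y + suc k ≤ N → x + k ≤ N
      one-step {x} {y} p q = ≤-trans (+-monoˡ-≤ k p) (≤-trans (≤-reflexive (sym (+-suc y k))) q)
      written-length : length (write MA t₂ j wo) + k ≤ N
      written-length = m≤o∸n⇒m+n≤o _ k≤N (length-write≤ MA t₂ j wo
          (m+n≤o⇒m≤o∸n _ (≤-trans (+-monoʳ-≤ (length t₂) (n≤1+n k)) len))
          (m+n≤o⇒m≤o∸n _ (≤-trans (≤-reflexive (sym (+-suc j k))) j≤)))
        where
        k≤N : k ≤ N
        k≤N = ≤-trans (≤-trans (n≤1+n k) (m≤n+m (suc k) i)) i≤
      written₂ : lay₂ (readCell MA (write MA t₂ j wo)) ≗
        upd (lay₂ (readCell MA t₂)) j (cell₂ (j ≡ᵇ 0) wo nothing)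
      written₂ k rewrite readCell-write MA t₂ j wo k with j ≡ᵇ k in e
      ... | false = refl
      ... | true  rewrite ≡ᵇ⇒≡ j k (subst T (sym e) _) = refl

    simulator-halts : ∀ w k → k ≤ N → result MA (run MA Bs k (initial MA w)) ≡ just r →
      Halts (suc (time N V k)) init (λ i → Machine.raw simulator (nth w i)) 0 empty₂ 0 r
    simulator-halts w k k≤N res = by-go refl
      (Halts-cong flagged (λ { zero → refl ; (suc _) → refl })
        (simA-halts k A.start (inputTape MA w) 0 [] 0 res k≤N k≤N k≤N))
      where
      flagged : lay₁ unmarked (readCell MA (inputTape MA w)) clean ≗
        upd (λ i → Machine.raw simulator (nth w i)) 0 (cell₁ true false (Maybe.map inj₁ (nth w 0)) nothing)
      flagged zero    = cong (λ x → cell₁ true false x nothing) (readCell-input MA w 0)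
      flagged (suc i) = cong (λ x → cell₁ false false x nothing) (readCell-input MA w (suc i))

-- Total running time

module _ {Z : ℕ} (10≤Z : 10 ≤ Z) where
  open ≤-Reasoning

  -- Apart from `n`, the cost is `8 + 6 * N + 3 * V`. As `8 ≤ Z`, this is at most `10 * Z`, and
  -- `10 ≤ Z` turns it into a square.
  query-cost≤ : ∀ {N V} → N ≤ Z → V ≤ Z → ∀ n → query-cost N V n ≤ Z * Z + n
  query-cost≤ {N} {V} N≤ V≤ n = begin
    query-cost N V n              ≡⟨ expand N V n ⟩
    (8 + (6 * N + 3 * V)) + n     ≤⟨ +-monoˡ-≤ n (+-mono-≤ (≤-trans (m≤n+m 8 2) 10≤Z) (+-mono-≤ (*-monoʳ-≤ 6 N≤) (*-monoʳ-≤ 3 V≤))) ⟩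
    (Z + (6 * Z + 3 * Z)) + n     ≡⟨ collect Z n ⟩
    10 * Z + n                    ≤⟨ +-monoˡ-≤ n (*-monoˡ-≤ Z 10≤Z) ⟩
    Z * Z + n                     ∎
    where
    expand : ∀ N V n → suc (suc N + (suc N + (suc N + (suc V + (suc (N + V) + (suc (N + V) + (suc N + n)))))))
      ≡ (8 + (6 * N + 3 * V)) + n
    expand = solve-∀
    collect : ∀ Z n → (Z + (6 * Z + 3 * Z)) + n ≡ 10 * Z + n
    collect = solve-∀

  time≤ : ∀ {N V} → N ≤ Z → V ≤ Z → ∀ k → time N V k ≤ k * (Z * Z) + 1
  time≤ N≤ V≤ zero = ≤-refl
  time≤ {N} {V} N≤ V≤ (suc k) = begin
    query-cost N V (time N V k)     ≤⟨ query-cost≤ N≤ V≤ _ ⟩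
    Z * Z + time N V k              ≤⟨ +-monoʳ-≤ (Z * Z) (time≤ N≤ V≤ k) ⟩
    Z * Z + (k * (Z * Z) + 1)       ≡⟨ +-assoc (Z * Z) _ 1 ⟨
    suc k * (Z * Z) + 1             ∎

  -- At most `Z` steps of `MA` at a cost of `Z * Z` each give a cube; the factor 3 of the
  -- compilation and the additive constants lift it to a fourth power.
  simulation-time≤ : ∀ {N V} → N ≤ Z → V ≤ Z → suc (time N V N) * 3 ≤ (Z * Z) * (Z * Z)
  simulation-time≤ {N} {V} N≤ V≤ = begin
    suc (time N V N) * 3               ≤⟨ *-monoˡ-≤ 3 (s≤s (≤-trans (time≤ N≤ V≤ N) (+-monoˡ-≤ 1 (*-monoˡ-≤ (Z * Z) N≤)))) ⟩
    suc (Z * (Z * Z) + 1) * 3          ≡⟨ expand (Z * (Z * Z)) ⟩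
    6 + 3 * (Z * (Z * Z))              ≤⟨ +-monoˡ-≤ _ 6≤Z³ ⟩
    Z * (Z * Z) + 3 * (Z * (Z * Z))    ≡⟨⟩
    4 * (Z * (Z * Z))                  ≤⟨ *-monoˡ-≤ (Z * (Z * Z)) (≤-trans (m≤n+m 4 6) 10≤Z) ⟩
    Z * (Z * (Z * Z))                  ≡⟨ *-assoc Z Z (Z * Z) ⟨
    (Z * Z) * (Z * Z)                  ∎
    where
    expand : ∀ c → suc (c + 1) * 3 ≡ 6 + 3 * c
    expand = solve-∀
    1≤Z : 1 ≤ Z
    1≤Z = ≤-trans (s≤s z≤n) 10≤Z
    6≤Z³ : 6 ≤ Z * (Z * Z)
    6≤Z³ = *-mono-≤ (≤-trans (m≤n+m 6 4) 10≤Z) (*-mono-≤ 1≤Z 1≤Z)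

-- The machine is fixed before `w` and `V`: the bound `V` belongs to the time estimate and is never
-- computed by the machine.
simulation : ∀ {a b} (MA : OTM a b) (MB : OTM b 0) {A : Lang a} {B : Lang b} {f t : ℕ → ℕ} →
  DecidesIn MA B A f → DecidesIn MB noOracle B t →
  Σ (OTM a 0) λ M → ∀ w V → (∀ l → l ≤ f (length w) → t l ≤ V) →
    ∀ T → suc (time (f (length w)) V (f (length w))) * 3 ≤ T →
    result M (run M noOracle T (initial M w)) ≡ just (A w)
simulation MA MB {A} {B} {f} {t} decA decB = otm , λ w V t≤V T bound →
  halts⇒decides {w} (simulator-halts B t decB (f (length w)) V t≤V w (f (length w)) ≤-refl (decA w)) bound
  where
  open Simulator MA MB
  open Compile simulator

theorem4p7 : (α : Ord) → NF α → fin 3 ≤ₒ α → {a b : ℕ} → (A : Lang a) → (B : Lang b) → ≤T-F< α A B → 𝐅 α B → 𝐅 α A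
theorem4p7 α nα 3≤α A B (f , (β , nβ , β<α , f∈) , MA , decA) (p , (γ , nγ , γ<α , p∈) , tB , tB-graph , MB , decB)
  with common-bound (β , nβ , β<α) (γ , nγ , γ<α)
... | ε , β≤ε , γ≤ε
  -- `fin 1` joins the bound to make `δ` nonzero, as `InF-bounded` demands; it is below `α` because
  -- `fin 3` is at most `α`.
  with common-bound ε (fin 1 , NF-fin 1 , <ₒ-≤ₒ-trans (tail< 0<) 3≤α)
... | (δ , nδ , δ<α) , ε≤δ , 1≤δ
  with InF-bounded 1≤δ nβ nδ (≤ₒ-trans β≤ε ε≤δ) f∈ | InF-bounded 1≤δ nγ nδ (≤ₒ-trans γ≤ε ε≤δ) p∈
     | ≤ₒ⇒≼ (NF-fin 3) nα 3≤α | simulation MA MB {f = λ n → f (n ∷ [])} decA decB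
... | kf , f≤ | kp , p≤ | c , 3≼α | M , simulates =
  p′ , (δ , nδ , δ<α , iter-InF δ K) , (λ n → F α (p′ (n ∷ []))) , (λ n → F-graph α _) , M , λ w →
    simulates w (Z (length w)) (query-time≤ (length w)) _ (time-bound (length w))
  where
  open ≤-Reasoning
  infl : ∀ x → x < F δ x
  infl = F-infl δ
  K₀ K : ℕ
  -- `kf` and `kp` iterations dominate `f` and `p`. The summand 10 yields `10 ≤ Z n`, and `c` raises
  -- the argument to an index at which `fin 3` is pointwise below `α`. The 2 in `K` pays for the two
  -- shifts in `square²≤F`.
  K₀ = kf + kp + (10 + c)
  K  = K₀ + 2
  p′ : Vec ℕ 1 → ℕ
  p′ v = iter (F δ) K (lookup v Fin.zero)
  arg Z : ℕ → ℕ
  arg n = iter (F δ) K₀ n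
  Z n = F α (arg n)
  const≤arg : ∀ n → 10 + c ≤ arg n
  const≤arg n = begin
    10 + c     ≤⟨ m≤n+m (10 + c) (kf + kp) ⟩
    K₀         ≤⟨ m≤m+n K₀ n ⟩
    K₀ + n     ≤⟨ iter-infl infl K₀ n ⟩
    arg n        ∎
  10≤Z : ∀ n → 10 ≤ Z n
  10≤Z n = ≤-trans (≤-trans (m≤m+n 10 c) (const≤arg n)) (<⇒≤ (F-infl α (arg n)))
  f≤iter : ∀ n → f (n ∷ []) ≤ iter (F δ) kf n
  f≤iter n = ≤-trans (f≤ (n ∷ [])) (≤-reflexive (cong (iter (F δ) kf) (⊔-identityʳ n)))
  f≤Z : ∀ n → f (n ∷ []) ≤ Z n
  f≤Z n = begin
    f (n ∷ [])          ≤⟨ f≤iter n ⟩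
    iter (F δ) kf n     ≤⟨ iter-mono-count infl (≤-trans (m≤m+n kf kp) (m≤m+n (kf + kp) _)) n ⟩
    arg n                 ≤⟨ <⇒≤ (F-infl α (arg n)) ⟩
    Z n                 ∎
  query-time≤ : ∀ n l → l ≤ f (n ∷ []) → tB l ≤ Z n
  query-time≤ n l l≤ = begin
    tB l                       ≡⟨ FG-det (tB-graph l) (F-graph α (p (l ∷ []))) ⟩
    F α (p (l ∷ []))           ≤⟨ F-mono α p≤arg ⟩
    Z n                        ∎
    where
    p≤arg : p (l ∷ []) ≤ arg n
    p≤arg = begin
      p (l ∷ [])                             ≤⟨ p≤ (l ∷ []) ⟩
      iter (F δ) kp (l ⊔ 0)                  ≡⟨ cong (iter (F δ) kp) (⊔-identityʳ l) ⟩
      iter (F δ) kp l                        ≤⟨ iter-F-mono δ kp (≤-trans l≤ (f≤iter n)) ⟩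
      iter (F δ) kp (iter (F δ) kf n)        ≡⟨ iter-+ (F δ) kf kp n ⟨
      iter (F δ) (kf + kp) n                 ≤⟨ iter-mono-count infl (m≤m+n (kf + kp) _) n ⟩
      arg n                                    ∎
  time-bound : ∀ n → suc (time (f (n ∷ [])) (Z n) (f (n ∷ []))) * 3 ≤ F α (p′ (n ∷ []))
  time-bound n = begin
    _                                ≤⟨ simulation-time≤ (10≤Z n) (f≤Z n) ≤-refl ⟩
    (Z n * Z n) * (Z n * Z n)        ≤⟨ square²≤F (≼-mono (≤-trans (m≤n+m c 10) (const≤arg n)) 3≼α) ⟩
    F α (2 + arg n)                    ≤⟨ F-mono α (≤-trans (iter-infl infl 2 (arg n)) (≤-reflexive (sym (iter-+ (F δ) K₀ 2 n)))) ⟩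
    F α (p′ (n ∷ []))                ∎
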